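{- A real number $r$ is the asymptotic density of some d.c.e. set if and only if $r\in[0,1]$ and $r$ is a difference of two left-$\Pi^0_2$ reals (i.e. $r \in \mathcal{D}_2 \cap [0,1]$).
   Context: For $X \subseteq \omega=\{0,1,2,\dots\}$ and an integer $m>0$, let $\rho_m(X) = |\{j \in X : j < m\}|/m$. The set $X$ has a (asymptotic) density if $\lim_m \rho_m(X)$ exists, and the density is then $\rho(X) = \lim_m \rho_m(X)$. Saying that $r$ is the density of a set $X$ means that $X$ has a density and $\rho(X)=r$. A set is d.c.e. (equivalently, $2$-c.e.) if it is of the form $A\setminus B$ with $A,B\subseteq\omega$ computably enumerable. A real $r$ is left-$\Pi^0_2$ if its left Dedekind cut $\{q \in \mathbb{Q} : q < r\}$ is a $\Pi^0_2$ set. $\mathcal{D}_2$ is the set of all reals of the form $a-b$ where $a$ and $b$ are left-$\Pi^0_2$ reals. -}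

module Defs where

open import Data.Nat as ℕ using (ℕ; suc; NonZero)
open import Data.Fin using (Fin)
open import Data.Integer as ℤ using (+_; _⊖_)
open import Data.List using (length; filter; upTo)
open import Data.Product using (_×_; _,_; ∃; ∃-syntax; Σ-syntax)
open import Data.Rational as ℚ using (ℚ; 0ℚ; 1ℚ; _/_)
import Data.Rational.Properties as ℚ
open import Data.Sum using (_⊎_)
open import Data.Vec using (Vec; []; _∷_; lookup)
open import Data.Vec.Relation.Binary.Pointwise.Inductive using (Pointwise)
open import Function.Bundles using (_⇔_)
open import Level as Level using (0ℓ)
open import Relation.Binary.Definitions using (tri<; tri≈; tri>)
open import Relation.Binary.PropositionalEquality using (_≡_; refl; subst)
open import Relation.Nullary using (contradiction)
open import Relation.Unary using (Pred; Decidable; Empty; _∈_; _∉_; _⊆_; _≐_; _∖_)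

------------------------------------------------------------------------
-- Partial recursive functions

data Rec : ℕ → Set where
  zer  : Rec 0
  succ : Rec 1
  proj : ∀ {n} → Fin n → Rec n
  comp : ∀ {m n} → Rec m → Vec (Rec n) m → Rec n
  prec : ∀ {n} → Rec n → Rec (2 ℕ.+ n) → Rec (1 ℕ.+ n)
  mu   : ∀ {n} → Rec (1 ℕ.+ n) → Rec n

infix 4 _[_]⇓_

-- In prec f g the recursion variable is the first argument, and g receives
-- the predecessor followed by the previous value.
data _[_]⇓_ : ∀ {n} → Rec n → Vec ℕ n → ℕ → Set where
  zer   : zer [ [] ]⇓ 0
  succ  : ∀ {x} → succ [ x ∷ [] ]⇓ suc x
  proj  : ∀ {n} {i : Fin n} {xs} → proj i [ xs ]⇓ lookup xs i
  comp  : ∀ {m n} {f : Rec m} {gs : Vec (Rec n) m} {xs ys z} →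
          Pointwise (λ g y → g [ xs ]⇓ y) gs ys → f [ ys ]⇓ z →
          comp f gs [ xs ]⇓ z
  prec0 : ∀ {n} {f : Rec n} {g xs z} →
          f [ xs ]⇓ z → prec f g [ 0 ∷ xs ]⇓ z
  precs : ∀ {n} {f : Rec n} {g k xs y z} →
          prec f g [ k ∷ xs ]⇓ y → g [ k ∷ y ∷ xs ]⇓ z →
          prec f g [ suc k ∷ xs ]⇓ z
  mu    : ∀ {n} {f : Rec (1 ℕ.+ n)} {xs y} →
          (∀ i → i ℕ.< y → ∃[ k ] f [ i ∷ xs ]⇓ suc k) →
          f [ y ∷ xs ]⇓ 0 → mu f [ xs ]⇓ y

Computable : ∀ {n} → (Vec ℕ n → ℕ) → Set
Computable {n} f = Σ[ e ∈ Rec n ] (∀ xs → e [ xs ]⇓ f xs)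

ComputableRel : ∀ {n} → Pred (Vec ℕ n) 0ℓ → Set
ComputableRel R =
  ∃[ χ ] (Computable χ × (∀ xs → (xs ∈ R × χ xs ≡ 1) ⊎ (xs ∉ R × χ xs ≡ 0)))

ComputablyEnumerable : Pred ℕ 0ℓ → Set
ComputablyEnumerable A =
  Empty A ⊎ ∃[ f ] (Computable f × A ≐ (λ x → ∃[ n ] f (n ∷ []) ≡ x))

IsDCE : Pred ℕ 0ℓ → Set₁
IsDCE X = ∃[ A ] ∃[ B ] (ComputablyEnumerable A × ComputablyEnumerable B × X ≐ A ∖ B)

IsΠ⁰₂ : ∀ {n} → Pred (Vec ℕ n) 0ℓ → Set₁
IsΠ⁰₂ P =
  ∃[ R ] (ComputableRel R × (∀ v → v ∈ P ⇔ (∀ x → ∃[ y ] (x ∷ y ∷ v) ∈ R)))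

-- A surjective numbering of the rationals. Every rational has many codes;
-- a set of rationals is Π⁰₂ when the set of all codes of its members is.
decodeℚ : Vec ℕ 3 → ℚ
decodeℚ (a ∷ b ∷ c ∷ []) = (a ⊖ b) / suc c

IsΠ⁰₂ℚ : Pred ℚ 0ℓ → Set₁
IsΠ⁰₂ℚ S = IsΠ⁰₂ (λ v → decodeℚ v ∈ S)

------------------------------------------------------------------------
-- Real numbers as left Dedekind cuts. These are the textbook one-sided
-- cuts, and represent the real line correctly only in the presence of
-- excluded middle.

record ℝ : Set₁ where
  field
    cut       : Pred ℚ 0ℓ
    inhabited : ∃[ q ] q ∈ cut
    proper    : ∃[ q ] q ∉ cut
    downward  : ∀ {p q} → p ℚ.< q → q ∈ cut → p ∈ cut
    open′     : ∀ {p} → p ∈ cut → ∃[ q ] (p ℚ.< q × q ∈ cut)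

open ℝ public

infix 4 _≤ᵣ_ _<ᵣ_ _≃ᵣ_
infixl 6 _-ᵣ_

_≤ᵣ_ : ℝ → ℝ → Set
a ≤ᵣ b = cut a ⊆ cut b

_<ᵣ_ : ℝ → ℝ → Set
a <ᵣ b = ∃[ q ] (q ∉ cut a × q ∈ cut b)

_≃ᵣ_ : ℝ → ℝ → Set
a ≃ᵣ b = cut a ≐ cut b

private
  q-1<q : ∀ q → q ℚ.- 1ℚ ℚ.< q
  q-1<q q = subst (q ℚ.- 1ℚ ℚ.<_) (ℚ.+-identityʳ q)
              (ℚ.+-monoʳ-< q {ℚ.- 1ℚ} {0ℚ} (ℚ.negative⁻¹ (ℚ.- 1ℚ)))

  ∈∉⇒< : ∀ (a : ℝ) {p q} → p ∈ cut a → q ∉ cut a → p ℚ.< q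
  ∈∉⇒< a {p} {q} p∈a q∉a with ℚ.<-cmp p q
  ... | tri< p<q _ _  = p<q
  ... | tri≈ _ refl _ = contradiction p∈a q∉a
  ... | tri> _ _ q<p  = contradiction (downward a q<p p∈a) q∉a

fromℚ : ℚ → ℝ
fromℚ q = record
  { cut       = ℚ._< q
  ; inhabited = q ℚ.- 1ℚ , q-1<q q
  ; proper    = q , ℚ.<-irrefl refl
  ; downward  = ℚ.<-trans
  ; open′     = ℚ.<-dense
  }

_-ᵣ_ : ℝ → ℝ → ℝ
a -ᵣ b = record
  { cut       = λ q → ∃[ s ] ∃[ t ] (s ∈ cut a × t ∉ cut b × q ℚ.< s ℚ.- t)
  ; inhabited = let s , s∈a = inhabited a
                    t , t∉b = proper b
                in (s ℚ.- t) ℚ.- 1ℚ , s , t , s∈a , t∉b , q-1<q (s ℚ.- t)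
  ; proper    = let u , u∉a = proper a
                    l , l∈b = inhabited b
                in u ℚ.- l , λ { (s , t , s∈a , t∉b , u-l<s-t) →
                     ℚ.<-asym u-l<s-t
                       (ℚ.+-mono-< (∈∉⇒< a s∈a u∉a)
                                   (ℚ.neg-antimono-< (∈∉⇒< b l∈b t∉b))) }
  ; downward  = λ { p<q (s , t , s∈a , t∉b , q<s-t) →
                    s , t , s∈a , t∉b , ℚ.<-trans p<q q<s-t }
  ; open′     = λ { (s , t , s∈a , t∉b , p<s-t) →
                    let q , p<q , q<s-t = ℚ.<-dense p<s-t
                    in q , p<q , s , t , s∈a , t∉b , q<s-t }
  }

LeftΠ⁰₂ : ℝ → Set₁
LeftΠ⁰₂ r = IsΠ⁰₂ℚ (cut r)

𝓓₂ : Pred ℝ (Level.suc 0ℓ)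
𝓓₂ r = ∃[ a ] ∃[ b ] (LeftΠ⁰₂ a × LeftΠ⁰₂ b × r ≃ᵣ a -ᵣ b)

------------------------------------------------------------------------
-- Asymptotic density

ρ : ∀ {X : Pred ℕ 0ℓ} → Decidable X → (m : ℕ) → .{{NonZero m}} → ℚ
ρ X? m = + length (filter X? (upTo m)) / m

IsDensity : ∀ {X : Pred ℕ 0ℓ} → Decidable X → ℝ → Set
IsDensity X? r =
  ∀ ε → 0ℚ ℚ.< ε → ∃[ N ] (∀ m → .{{_ : NonZero m}} → N ℕ.≤ m →
    fromℚ (ρ X? m ℚ.- ε) <ᵣ r × r <ᵣ fromℚ (ρ X? m ℚ.+ ε))

{-# OPTIONS --safe #-}
module Submission where

-- (⇒) If X = A ∖ B has density r then ρ(A ∪ B) - ρ(B) = ρ(X) tends to r, so r is the difference of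
-- the upper densities of A ∪ B and B; the upper density of a c.e. set is left-Π⁰₂.
--
-- (⇐) Let r = a - b be less than 1 and choose a rational c₀ with a - 1 ≤ c₀ < b, so that both
-- α = a - c₀ and β = b - c₀ lie in [0,1]. Fix a computable equidistributed sequence of rationals
-- p(n) in [0,1). A Π⁰₂ description of the cut of α yields a c.e. set A which contains every n with
-- p(n) < α and, for each rational q > α, only finitely many n with p(n) ≥ q. With B obtained in
-- the same way from β, the set A ∖ B has density α - β = r.

open import Defs
open import Axiom.ExcludedMiddle using (ExcludedMiddle)
open import Data.Empty using (⊥)
open import Data.Fin.Patterns using (0F; 1F; 2F; 3F; 4F)
open import Data.Nat as ℕ using (ℕ; zero; suc)
import Data.Nat.Properties as ℕ
import Data.Nat.Tactic.RingSolver as ℕ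
open import Data.Product using (_×_; _,_; proj₁; proj₂; ∃-syntax; Σ-syntax)
open import Data.Sum using (_⊎_; inj₁; inj₂; [_,_]′)
open import Data.Unit using (⊤; tt)
open import Data.Vec using (Vec; []; _∷_; lookup; tail)
open import Function using (_∘_; id)
open import Function.Bundles using (_⇔_; mk⇔; Equivalence)
open import Level using (0ℓ)
open import Relation.Binary.Definitions using (tri<; tri≈; tri>)
open import Relation.Binary.PropositionalEquality hiding ([_])
open import Relation.Nullary using (¬_; Dec; yes; no; contradiction)
open import Relation.Unary using (Pred; Decidable; _∈_; _∉_; _⊆_; _∪_; _∖_; _≐_)
open Equivalence using (to; from)

-- Neither ρ(A ∪ B) nor ρ(B) need converge. Upper densities still subtract correctly because ρ(X)
-- does converge, and adding a convergent sequence shifts a limsup by its limit. The Π⁰₂ bound holds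
-- because counts of a c.e. set are approximated from below: "ρ_m ≥ q" is Σ₁, and "for infinitely
-- many m" puts one ∀ in front. The set of such q may contain its supremum, which a cut must not.
--
-- In the converse no c.e. set can be expected to decide p(n) < α. The set A is wrong at finitely
-- many points beyond each rational q > α, but how many depends on q, with no uniform bound as q
-- approaches α. Densities are therefore compared on a grid of fixed mesh: α and β are each enclosed
-- in one cell, finitely many exceptional n are discarded, and the mesh is chosen from ε only at the
-- end. The value r = 1 is excluded from this construction because a - 1 ≤ c₀ < b forces a - b < 1.

module Arithmetic where

  open import Data.Fin using (Fin; suc)
  open import Data.List using (length; filter; upTo; [_]; _++_)
  open import Data.List.Properties using (filter-++; length-++; upTo-∷ʳ)
  open import Data.Nat
  open import Data.Nat.Properties
  open import Data.Nat.Tactic.RingSolver using (solve-∀)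
  open import Data.Vec using (map; tabulate)
  open import Data.Vec.Relation.Binary.Pointwise.Inductive using (Pointwise; []; _∷_)

  -- Closure properties of the computable functions.

  private variable
    m n : ℕ
    f g t : Vec ℕ n → ℕ

  Computables : (Vec ℕ n → Vec ℕ m) → Set
  Computables {n} {m} h =
    Σ[ es ∈ Vec (Rec n) m ] (∀ xs → Pointwise (λ e y → e [ xs ]⇓ y) es (h xs))

  computable-≗ : f ≗ g → Computable f → Computable g
  computable-≗ f≗g (e , e⇓) = e , λ xs → subst (e [ xs ]⇓_) (f≗g xs) (e⇓ xs)

  varᶜ : (i : Fin n) → Computable (λ xs → lookup xs i)
  varᶜ i = proj i , λ _ → proj

  []ᶜ : Computables {n} (λ _ → [])
  []ᶜ = [] , λ _ → []

  infixr 5 _∷ᶜ_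
  _∷ᶜ_ : ∀ {h : Vec ℕ n → Vec ℕ m} → Computable f → Computables h →
         Computables (λ xs → f xs ∷ h xs)
  (e , e⇓) ∷ᶜ (es , es⇓) = e ∷ es , λ xs → e⇓ xs ∷ es⇓ xs

  compᶜ : ∀ {h : Vec ℕ n → Vec ℕ m} → Computable f → Computables h → Computable (f ∘ h)
  compᶜ (e , e⇓) (es , es⇓) = comp e es , λ xs → comp (es⇓ xs) (e⇓ _)

  weakenᶜ : ∀ {h : Vec ℕ n → Vec ℕ m} → Computables h → Computables (h ∘ tail)
  weakenᶜ {n} {h = h} (es , es⇓) = map weaken es , λ { (x ∷ xs) → weaken-⇓ es (es⇓ xs) }
    where
    variables : Vec (Rec (suc n)) n
    variables = tabulate (λ i → proj (suc i))

    weaken : Rec n → Rec (suc n)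
    weaken e = comp e variables

    variables-⇓ : ∀ {k x} {ws : Vec ℕ k} {xs : Vec ℕ n} (ι : Fin k → Fin n) →
        (∀ i → lookup xs (ι i) ≡ lookup ws i) →
                  Pointwise (λ e y → e [ x ∷ xs ]⇓ y) (tabulate (λ i → proj (suc (ι i)))) ws
    variables-⇓ {ws = []}     ι eq = []
    variables-⇓ {x = x} {ws = w ∷ ws} {xs} ι eq =
      subst (proj (suc (ι 0F)) [ x ∷ xs ]⇓_) (eq 0F) proj ∷ variables-⇓ (ι ∘ suc) (eq ∘ suc)

    weaken-⇓ : ∀ {k x xs} {ys : Vec ℕ k} (es : Vec (Rec n) k) →
        Pointwise (λ e y → e [ xs ]⇓ y) es ys →
               Pointwise (λ e y → e [ x ∷ xs ]⇓ y) (map weaken es) ys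
    weaken-⇓ [] [] = []
    weaken-⇓ (e ∷ es) (e⇓ ∷ es⇓) = comp (variables-⇓ id (λ _ → refl)) e⇓ ∷ weaken-⇓ es es⇓

  idᶜ : Computables {n} id
  idᶜ {zero}  = [] , λ { [] → [] }
  idᶜ {suc n} = let es , es⇓ = varᶜ 0F ∷ᶜ weakenᶜ idᶜ in es , λ { (x ∷ xs) → es⇓ (x ∷ xs) }

  sucᶜ : Computable f → Computable (suc ∘ f)
  sucᶜ (e , e⇓) = comp succ (e ∷ []) , λ xs → comp (e⇓ xs ∷ []) succ

  litᶜ : ∀ k → Computable {n} (λ _ → k)
  litᶜ zero    = comp zer [] , λ _ → comp [] zer
  litᶜ (suc k) = sucᶜ (litᶜ k)

  -- Mirrors the evaluation of `prec` clause by clause. Each arithmetic operation below is shown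
  -- computable by being recognised as an instance.
  primrec : ℕ → (ℕ → ℕ → ℕ) → ℕ → ℕ
  primrec b s zero    = b
  primrec b s (suc k) = s k (primrec b s k)

  recᶜ : ∀ {s : Vec ℕ (2 + n) → ℕ} → Computable f → Computable s → Computable t →
         Computable (λ xs → primrec (f xs) (λ k y → s (k ∷ y ∷ xs)) (t xs))
  recᶜ {f = f} {s = s} (eb , eb⇓) (es , es⇓) (et , et⇓) =
    comp (prec eb es) (et ∷ proj₁ idᶜ) , λ xs → comp (et⇓ xs ∷ proj₂ idᶜ xs) (run xs _)
    where
    run : ∀ xs k → prec eb es [ k ∷ xs ]⇓ primrec (f xs) (λ k y → s (k ∷ y ∷ xs)) k
    run xs zero    = prec0 (eb⇓ xs)
    run xs (suc k) = precs (run xs k) (es⇓ _)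

  infixl 6 _+ᶜ_ _∸ᶜ_
  infixl 7 _*ᶜ_

  _+ᶜ_ : Computable f → Computable g → Computable (λ xs → f xs + g xs)
  _+ᶜ_ {f = f} {g = g} cf cg = computable-≗ (λ xs → +-rec (f xs) (g xs))
      (recᶜ cf (sucᶜ (varᶜ 1F)) cg)
    where
    +-rec : ∀ x y → primrec x (λ _ → suc) y ≡ x + y
    +-rec x zero    = sym (+-identityʳ x)
    +-rec x (suc y) = trans (cong suc (+-rec x y)) (sym (+-suc x y))

  predᶜ : Computable f → Computable (pred ∘ f)
  predᶜ {f = f} cf = computable-≗ (λ xs → pred-rec (f xs)) (recᶜ (litᶜ 0) (varᶜ 0F) cf)
    where
    pred-rec : ∀ x → primrec 0 (λ k _ → k) x ≡ pred x
    pred-rec zero    = refl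
    pred-rec (suc x) = refl

  _∸ᶜ_ : Computable f → Computable g → Computable (λ xs → f xs ∸ g xs)
  _∸ᶜ_ {f = f} {g = g} cf cg =
    computable-≗ (λ xs → ∸-rec (f xs) (g xs)) (recᶜ cf (predᶜ (varᶜ 1F)) cg)
    where
    ∸-rec : ∀ x y → primrec x (λ _ → pred) y ≡ x ∸ y
    ∸-rec x zero    = refl
    ∸-rec x (suc y) = trans (cong pred (∸-rec x y)) (pred[m∸n]≡m∸[1+n] x y)

  _*ᶜ_ : Computable f → Computable g → Computable (λ xs → f xs * g xs)
  _*ᶜ_ {f = f} {g = g} cf cg =
    computable-≗ (λ xs → *-rec (f xs) (g xs))
        (recᶜ (litᶜ 0) (compᶜ cg (weakenᶜ (weakenᶜ idᶜ)) +ᶜ varᶜ 1F) cf)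
    where
    *-rec : ∀ x y → primrec 0 (λ _ z → y + z) x ≡ x * y
    *-rec zero    y = refl
    *-rec (suc x) y = cong (y +_) (*-rec x y)

  -- With 0 read as "true", vanishing of `∑<` is a bounded universal quantifier and vanishing of
  -- `∏<` a bounded existential one.
  ∑< ∏< : ℕ → (ℕ → ℕ) → ℕ
  ∑< n h = primrec 0 (λ k y → y + h k) n
  ∏< n h = primrec 1 (λ k y → y * h k) n

  ∑<ᶜ : ∀ {h : Vec ℕ (suc n) → ℕ} → Computable t → Computable h →
        Computable (λ xs → ∑< (t xs) (λ i → h (i ∷ xs)))
  ∑<ᶜ ct ch = recᶜ (litᶜ 0) (varᶜ 1F +ᶜ compᶜ ch (varᶜ 0F ∷ᶜ weakenᶜ (weakenᶜ idᶜ))) ct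

  ∏<ᶜ : ∀ {h : Vec ℕ (suc n) → ℕ} → Computable t → Computable h →
        Computable (λ xs → ∏< (t xs) (λ i → h (i ∷ xs)))
  ∏<ᶜ ct ch = recᶜ (litᶜ 1) (varᶜ 1F *ᶜ compᶜ ch (varᶜ 0F ∷ᶜ weakenᶜ (weakenᶜ idᶜ))) ct

  ≤pred⊎≡ : ∀ {i n} → i < suc n → i < n ⊎ i ≡ n
  ≤pred⊎≡ = m≤n⇒m<n∨m≡n ∘ s≤s⁻¹

  ∑<≡0 : ∀ n {h} → (∀ i → i < n → h i ≡ 0) → ∑< n h ≡ 0
  ∑<≡0 zero    h≡0 = refl
  ∑<≡0 (suc n) h≡0 = cong₂ _+_ (∑<≡0 n λ i i<n → h≡0 i (m<n⇒m<1+n i<n)) (h≡0 n ≤-refl)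

  ∑<≡0⁻¹ : ∀ n {h} → ∑< n h ≡ 0 → ∀ i → i < n → h i ≡ 0
  ∑<≡0⁻¹ (suc n) {h} ∑≡0 i i<1+n with ≤pred⊎≡ i<1+n
  ... | inj₁ i<n  = ∑<≡0⁻¹ n (m+n≡0⇒m≡0 _ ∑≡0) i i<n
  ... | inj₂ refl = m+n≡0⇒n≡0 (∑< n h) ∑≡0

  ∏<≡0 : ∀ n {h} i → i < n → h i ≡ 0 → ∏< n h ≡ 0
  ∏<≡0 (suc n) {h} i i<1+n hi≡0 with ≤pred⊎≡ i<1+n
  ... | inj₁ i<n  = cong (_* h n) (∏<≡0 n i i<n hi≡0)
  ... | inj₂ refl = trans (cong (∏< n h *_) hi≡0) (*-zeroʳ (∏< n h))

  ∏<≡0⁻¹ : ∀ n {h} → ∏< n h ≡ 0 → ∃[ i ] (i < n × h i ≡ 0)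
  ∏<≡0⁻¹ (suc n) {h} ∏≡0 with m*n≡0⇒m≡0∨n≡0 (∏< n h) ∏≡0
  ... | inj₁ eq = let i , i<n , hi≡0 = ∏<≡0⁻¹ n eq in i , m<n⇒m<1+n i<n , hi≡0
  ... | inj₂ eq = n , ≤-refl , eq

  -- Collection: finitely many witnesses have a common bound, so a single number can stand for a
  -- whole finite family of them.
  bounded-choice : ∀ n {h : ℕ → ℕ → ℕ} → (∀ i → i < n → ∃[ y ] h i y ≡ 0) →
                   ∃[ Y ] ∀ i → i < n → ∃[ y ] (y < Y × h i y ≡ 0)
  bounded-choice zero    _ = 0 , λ _ ()
  bounded-choice (suc n) {h} wit with bounded-choice n (λ i i<n → wit i (m<n⇒m<1+n i<n)) | wit n
      ≤-refl
  ... | Y , below | y , hny≡0 = Y + suc y , bound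
    where
    bound : ∀ i → i < suc n → ∃[ z ] (z < Y + suc y × h i z ≡ 0)
    bound i i<1+n with ≤pred⊎≡ i<1+n
    ... | inj₁ i<n  = let z , z<Y , eq = below i i<n in z , <-≤-trans z<Y (m≤m+n Y (suc y)) , eq
    ... | inj₂ refl = y , m≤n+m (suc y) Y , hny≡0

  -- Cantor's pairing: ω is cut into consecutive blocks, the k-th of length k + 1;
  -- n is the element number offset n of the block number block n.

  triangle : ℕ → ℕ
  triangle zero    = 0
  triangle (suc k) = triangle k + suc k

  -- The increment is 1 exactly when n + 1 has reached the start of the next block, and 0 otherwise.
  -- This form makes `block` visibly primitive recursive.
  block : ℕ → ℕ
  block zero    = 0
  block (suc n) = block n + (1 ∸ (triangle (suc (block n)) ∸ suc n))

  offset : ℕ → ℕ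
  offset n = n ∸ triangle (block n)

  data Step (n : ℕ) : Set where
    inside : offset n < block n → block (suc n) ≡ block n → offset (suc n) ≡ suc (offset n) → Step n
    jump   : offset n ≡ block n → block (suc n) ≡ suc (block n) → offset (suc n) ≡ 0 → Step n

  unpair-spec : ∀ n → triangle (block n) + offset n ≡ n × offset n ≤ block n × Step n
  unpair-spec n = eq n , bound n , step n (eq n) (bound n)
    where
    step : ∀ n → triangle (block n) + offset n ≡ n → offset n ≤ block n → Step n
    step n e o≤b with m≤n⇒m<n∨m≡n o≤b
    ... | inj₁ o<b = inside o<b same
        (trans (cong (λ k → suc n ∸ triangle k) same) (+-∸-assoc 1 t≤n))
      where
      t≤n : triangle (block n) ≤ n
      t≤n = subst (triangle (block n) ≤_) e (m≤m+n _ _)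
      early : suc n < triangle (suc (block n))
      early = subst (λ z → suc z < triangle (suc (block n))) e
        (≤-<-trans (≤-reflexive (sym (+-suc _ (offset n))))
            (+-monoʳ-< (triangle (block n)) (s≤s o<b)))
      same : block (suc n) ≡ block n
      same with triangle (suc (block n)) ∸ suc n in eq′
      ... | zero  = contradiction (m∸n≡0⇒m≤n eq′) (<⇒≱ early)
      ... | suc x = trans (cong (block n +_) (0∸n≡0 x)) (+-identityʳ (block n))
    ... | inj₂ o≡b = jump o≡b next
        (trans (cong (λ k → suc n ∸ triangle k) next)
        (trans (cong (suc n ∸_) late) (n∸n≡0 (suc n))))
      where
      late : triangle (suc (block n)) ≡ suc n
      late = trans (+-suc _ _) (cong suc (trans (cong (triangle (block n) +_) (sym o≡b)) e))
      next : block (suc n) ≡ suc (block n)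
      next = trans (cong (λ z → block n + (1 ∸ z)) (trans (cong (_∸ suc n) late) (n∸n≡0 n)))
          (+-comm (block n) 1)

    both : ∀ n → triangle (block n) + offset n ≡ n × offset n ≤ block n
    both zero = refl , z≤n
    both (suc n) with both n
    ... | e , b with step n e b
    ...   | inside o<b same next =
            trans (cong₂ (λ x y → triangle x + y) same next) (trans (+-suc _ _) (cong suc e)) ,
            subst₂ _≤_ (sym next) (sym same) o<b
    ...   | jump o≡b next zero′ =
            trans (cong₂ (λ x y → triangle x + y) next zero′)
              (trans (+-identityʳ _) (trans (+-suc _ _)
                  (cong suc (trans (cong (triangle (block n) +_) (sym o≡b)) e)))) ,
            ≤-trans (≤-reflexive zero′) z≤n

    eq : ∀ n → triangle (block n) + offset n ≡ n
    eq n = proj₁ (both n)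
    bound : ∀ n → offset n ≤ block n
    bound n = proj₂ (both n)

  -- Induction along the enumeration: j > 0 is the successor of offset j - 1 in the same block, and
  -- j = 0 the successor of the last element of the previous block. The other constructor of `Step`
  -- contradicts the offset already known.
  pair : ∀ k j → j ≤ k → block (triangle k + j) ≡ k × offset (triangle k + j) ≡ j
  pair zero zero z≤n = refl , refl
  pair (suc k) zero z≤n with pair k k ≤-refl | proj₂ (proj₂ (unpair-spec (triangle k + k)))
  ... | b≡ , o≡ | inside o<b _ _ = contradiction (subst₂ _<_ o≡ b≡ o<b) (n≮n k)
  ... | b≡ , o≡ | jump _ next zero′ =
        subst (λ z → block z ≡ suc k × offset z ≡ 0)
            (trans (sym (+-suc (triangle k) k)) (sym (+-identityʳ _)))
          (trans next (cong suc b≡) , zero′)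
  pair k (suc j) j<k with pair k j (<⇒≤ j<k) | proj₂ (proj₂ (unpair-spec (triangle k + j)))
  ... | b≡ , o≡ | inside _ same next =
        subst (λ z → block z ≡ k × offset z ≡ suc j) (sym (+-suc (triangle k) j))
            (trans same b≡ , trans next (cong suc o≡))
  ... | b≡ , o≡ | jump o≡b _ _ = contradiction (trans (sym o≡) (trans o≡b b≡)) (<⇒≢ j<k)

  triangleᶜ : Computable f → Computable (triangle ∘ f)
  triangleᶜ {f = f} cf = computable-≗ (λ xs → lemma (f xs))
      (recᶜ (litᶜ 0) (varᶜ 1F +ᶜ sucᶜ (varᶜ 0F)) cf)
    where
    lemma : ∀ x → primrec 0 (λ k y → y + suc k) x ≡ triangle x
    lemma zero    = refl
    lemma (suc x) = cong (_+ suc x) (lemma x)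

  blockᶜ : Computable f → Computable (block ∘ f)
  blockᶜ {f = f} cf = computable-≗ (λ xs → lemma (f xs))
    (recᶜ (litᶜ 0) (varᶜ 1F +ᶜ (litᶜ 1 ∸ᶜ (triangleᶜ (sucᶜ (varᶜ 1F)) ∸ᶜ sucᶜ (varᶜ 0F)))) cf)
    where
    lemma : ∀ x → primrec 0 (λ k y → y + (1 ∸ (triangle (suc y) ∸ suc k))) x ≡ block x
    lemma zero    = refl
    lemma (suc x) = cong (λ y → y + (1 ∸ (triangle (suc y) ∸ suc x))) (lemma x)

  offsetᶜ : Computable f → Computable (offset ∘ f)
  offsetᶜ cf = cf ∸ᶜ triangleᶜ (blockᶜ cf)

  π₁ π₂ : ℕ → ℕ
  π₁ = offset
  π₂ n = block n ∸ offset n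

  unpair-surjective : ∀ x y → ∃[ n ] (π₁ n ≡ x × π₂ n ≡ y)
  unpair-surjective x y with pair (x + y) x (m≤m+n x y)
  ... | b≡ , o≡ = triangle (x + y) + x , o≡ , trans (cong₂ _∸_ b≡ o≡) (m+n∸m≡n x y)

  -- A relation holds when its representing function vanishes, so that
  -- +, * and truncated subtraction act as ∧, ∨ and ≤.

  Σ₁ : Pred (Vec ℕ n) 0ℓ → Set
  Σ₁ P = ∃[ f ] (Computable f × (∀ v → P v ⇔ (∃[ y ] f (y ∷ v) ≡ 0)))

  private variable
    P Q : Pred (Vec ℕ n) 0ℓ

  Σ₁-∘ : ∀ {h : Vec ℕ n → Vec ℕ m} → Σ₁ P → Computables h → Σ₁ (P ∘ h)
  Σ₁-∘ {h = h} (f , cf , P⇔) ch =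
    (λ w → f (lookup w 0F ∷ h (tail w))) , compᶜ cf (varᶜ 0F ∷ᶜ weakenᶜ ch) , P⇔ ∘ h

  Σ₁-∪ : Σ₁ P → Σ₁ Q → Σ₁ (P ∪ Q)
  Σ₁-∪ {P = P} {Q = Q} (f , cf , P⇔) (g , cg , Q⇔) = (λ w → f w * g w) , cf *ᶜ cg , λ v → mk⇔
    [ (λ p → let y , eq = to (P⇔ v) p in y , cong (_* g (y ∷ v)) eq)
    , (λ q → let y , eq = to (Q⇔ v) q in y , trans (cong (f (y ∷ v) *_) eq) (*-zeroʳ (f (y ∷ v)))) ]′
    (λ { (y , eq) → [ (λ e → inj₁ (from (P⇔ v) (y , e))) , (λ e → inj₂ (from (Q⇔ v) (y , e))) ]′
                      (m*n≡0⇒m≡0∨n≡0 (f (y ∷ v)) eq) })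

  -- An implication stays Σ₁ because its premise is decidable: the factor 1 ∸ h is 0, hence "true",
  -- as soon as the premise fails.
  Σ₁-→ : Computable f → Σ₁ P → Σ₁ (λ v → f v ≡ 0 → P v)
  Σ₁-→ {f = h} {P = P} ch (f , cf , P⇔) =
    (λ w → (1 ∸ h (tail w)) * f w) , (litᶜ 1 ∸ᶜ compᶜ ch (weakenᶜ idᶜ)) *ᶜ cf ,
    λ v → mk⇔ (forth v) (back v)
    where
    forth : ∀ v → (h v ≡ 0 → P v) → ∃[ y ] (1 ∸ h v) * f (y ∷ v) ≡ 0
    forth v imp with h v
    ... | zero  = let y , eq = to (P⇔ v) (imp refl) in y , trans (+-identityʳ _) eq
    ... | suc x = 0 , cong (_* f (0 ∷ v)) (0∸n≡0 x)
    back : ∀ v → (∃[ y ] (1 ∸ h v) * f (y ∷ v) ≡ 0) → h v ≡ 0 → P v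
    back v (y , eq) hv≡0 =
      from (P⇔ v) (y , trans (sym (+-identityʳ _))
          (trans (cong (λ z → (1 ∸ z) * f (y ∷ v)) (sym hv≡0)) eq))

  -- The new witness is a common bound for the witnesses of all i below t, below which each i is
  -- then searched.
  Σ₁-∀< : Σ₁ P → Computable t → Σ₁ (λ v → ∀ i → i < t v → P (i ∷ v))
  Σ₁-∀< {t = t} (f , cf , P⇔) ct =
    (λ w → ∑< (t (tail w)) (λ i → ∏< (lookup w 0F) (λ y → f (y ∷ i ∷ tail w)))) ,
    ∑<ᶜ (compᶜ ct (weakenᶜ idᶜ))
        (∏<ᶜ (varᶜ 1F) (compᶜ cf (varᶜ 0F ∷ᶜ varᶜ 1F ∷ᶜ weakenᶜ (weakenᶜ (weakenᶜ idᶜ))))) ,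
    λ v → mk⇔
      (λ all → let Y , wit = bounded-choice (t v) (λ i i<t → to (P⇔ (i ∷ v)) (all i i<t)) in
        Y , ∑<≡0 (t v) (λ i i<t → let y , y<Y , eq = wit i i<t in ∏<≡0 Y y y<Y eq))
      (λ { (Y , eq) i i<t → let y , _ , e = ∏<≡0⁻¹ Y (∑<≡0⁻¹ (t v) eq i i<t) in from (P⇔ (i ∷ v)) (y , e) })


  -- Computably enumerable, `Σ₁` and Π⁰₂ relations.

  ce⇒Σ₁ : ∀ {A : Pred ℕ 0ℓ} → ComputablyEnumerable A → Σ₁ {1} (λ v → lookup v 0F ∈ A)
  ce⇒Σ₁ (inj₁ empty) = (λ _ → 1) , litᶜ 1 ,
      λ { (x ∷ []) → mk⇔ (λ x∈A → contradiction x∈A (empty x)) (λ ()) }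
  ce⇒Σ₁ (inj₂ (f , cf , A⊆ , ⊆A)) =
    (λ w → (F w ∸ lookup w 1F) + (lookup w 1F ∸ F w)) ,
    (cF ∸ᶜ varᶜ 1F) +ᶜ (varᶜ 1F ∸ᶜ cF) ,
    λ { (x ∷ []) → mk⇔
      (λ x∈A → let n , eq = A⊆ x∈A in n , cong₂ _+_ (m≤n⇒m∸n≡0 (≤-reflexive eq)) (m≤n⇒m∸n≡0 (≤-reflexive (sym eq))))
      (λ { (n , eq) → ⊆A (n , ≤-antisym (m∸n≡0⇒m≤n (m+n≡0⇒m≡0 _ eq))
          (m∸n≡0⇒m≤n (m+n≡0⇒n≡0 (f (n ∷ []) ∸ x) eq))) }) }
    where
    F : Vec ℕ 2 → ℕ
    F w = f (lookup w 0F ∷ [])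
    cF : Computable F
    cF = compᶜ cf (varᶜ 0F ∷ᶜ []ᶜ)

  Σ₁⇒ce : ExcludedMiddle 0ℓ → ∀ {P : Pred (Vec ℕ 1) 0ℓ} → Σ₁ P →
      ComputablyEnumerable (λ n → P (n ∷ []))
  Σ₁⇒ce em {P} (f , cf , P⇔) with em {∃[ n ] P (n ∷ [])}
  ... | no  none     = inj₁ λ n p → none (n , p)
  ... | yes (n₀ , p₀) = inj₂ (e , ce , (λ {x} → complete x) , λ { (t , refl) → sound t })
    where
    F : Vec ℕ 1 → ℕ
    F w = f (π₁ (lookup w 0F) ∷ π₂ (lookup w 0F) ∷ [])
    e : Vec ℕ 1 → ℕ
    -- An index t codes a pair (witness, element). A correct pair outputs its element; any other
    -- outputs the default n₀, which keeps the enumeration total.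
    e w = (1 ∸ F w) * π₂ (lookup w 0F) + (1 ∸ (1 ∸ F w)) * n₀
    π₁ᶜ = offsetᶜ (varᶜ {1} 0F)
    π₂ᶜ = blockᶜ (varᶜ {1} 0F) ∸ᶜ π₁ᶜ
    cF : Computable F
    cF = compᶜ cf (π₁ᶜ ∷ᶜ π₂ᶜ ∷ᶜ []ᶜ)
    ce : Computable e
    ce = (litᶜ 1 ∸ᶜ cF) *ᶜ π₂ᶜ +ᶜ (litᶜ 1 ∸ᶜ (litᶜ 1 ∸ᶜ cF)) *ᶜ litᶜ n₀
    e-hit : ∀ t → F (t ∷ []) ≡ 0 → e (t ∷ []) ≡ π₂ t
    e-hit t eq rewrite eq = trans (+-identityʳ _) (+-identityʳ _)
    e-miss : ∀ t {z} → F (t ∷ []) ≡ suc z → e (t ∷ []) ≡ n₀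
    e-miss t {z} eq rewrite eq | 0∸n≡0 z = +-identityʳ n₀
    complete : ∀ x → P (x ∷ []) → ∃[ t ] e (t ∷ []) ≡ x
    complete x p with to (P⇔ (x ∷ [])) p
    ... | y , fyx≡0 with unpair-surjective y x
    ...   | t , eq₁ , eq₂ = t ,
        trans (e-hit t (trans (cong₂ (λ a b → f (a ∷ b ∷ [])) eq₁ eq₂) fyx≡0)) eq₂
    sound : ∀ t → P (e (t ∷ []) ∷ [])
    sound t with F (t ∷ []) in eq
    ... | zero  = subst (λ z → P (z ∷ [])) (sym (trans (+-identityʳ _) (+-identityʳ _)))
        (from (P⇔ (π₂ t ∷ [])) (π₁ t , eq))
    ... | suc z = subst (λ n → P (n ∷ []))
        (sym (trans (cong (λ w → w * π₂ t + (1 ∸ w) * n₀) (0∸n≡0 z)) (+-identityʳ n₀))) p₀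

  Π₂⇒∀Σ₁ : ∀ {P : Pred (Vec ℕ n) 0ℓ} → IsΠ⁰₂ P →
            ∃[ Q ] (Σ₁ Q × (∀ v → P v ⇔ (∀ x → Q (x ∷ v))))
  Π₂⇒∀Σ₁ (R , (χ , cχ , R≡χ) , P⇔) =
    (λ w → ∃[ y ] F (y ∷ w) ≡ 0) ,
    (F , litᶜ 1 ∸ᶜ compᶜ cχ (varᶜ 1F ∷ᶜ varᶜ 0F ∷ᶜ weakenᶜ (weakenᶜ idᶜ)) , λ w → mk⇔ id id) ,
    λ v → mk⇔ (λ p x → let y , xyv∈R = to (P⇔ v) p x in y , forth xyv∈R)
               (λ q → from (P⇔ v) λ x → let y , eq = q x in y , back eq)
    where
    F : Vec ℕ _ → ℕ
    F w = 1 ∸ χ (lookup w 1F ∷ lookup w 0F ∷ tail (tail w))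
    forth : ∀ {w} → w ∈ R → 1 ∸ χ w ≡ 0
    forth {w} w∈R with R≡χ w
    ... | inj₁ (_ , eq)  = cong (1 ∸_) eq
    ... | inj₂ (w∉R , _) = contradiction w∈R w∉R
    back : ∀ {w} → 1 ∸ χ w ≡ 0 → w ∈ R
    back {w} eq with R≡χ w
    ... | inj₁ (w∈R , _)  = w∈R
    ... | inj₂ (_ , χ≡0) = contradiction (trans (sym (cong (1 ∸_) χ≡0)) eq) (λ ())

  ∀Σ₁⇒Π₂ : ∀ {P : Pred (Vec ℕ n) 0ℓ} {Q} → Σ₁ Q → (∀ v → P v ⇔ (∀ x → Q (x ∷ v))) → IsΠ⁰₂ P
  ∀Σ₁⇒Π₂ {n = n} (f , cf , Q⇔) P⇔ =
    (λ w → F w ≡ 0) ,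
    ((λ w → 1 ∸ F w) , litᶜ 1 ∸ᶜ compᶜ cf (varᶜ 1F ∷ᶜ varᶜ 0F ∷ᶜ weakenᶜ (weakenᶜ idᶜ)) , decide) ,
    λ v → mk⇔ (λ p x → to (Q⇔ (x ∷ v)) (to (P⇔ v) p x))
        (λ q → from (P⇔ v) λ x → from (Q⇔ (x ∷ v)) (q x))
    where
    F : Vec ℕ (2 + n) → ℕ
    F w = f (lookup w 1F ∷ lookup w 0F ∷ tail (tail w))
    decide : ∀ w → (F w ≡ 0 × 1 ∸ F w ≡ 1) ⊎ (F w ≢ 0 × 1 ∸ F w ≡ 0)
    decide w with F w
    ... | zero  = inj₁ (refl , refl)
    ... | suc z = inj₂ ((λ ()) , 0∸n≡0 z)

  -- Counting functions.

  ∑<-mono : ∀ m {g h} → (∀ i → i < m → g i ≤ h i) → ∑< m g ≤ ∑< m h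
  ∑<-mono zero    g≤h = z≤n
  ∑<-mono (suc m) g≤h = +-mono-≤ (∑<-mono m λ i i<m → g≤h i (m<n⇒m<1+n i<m)) (g≤h m ≤-refl)

  ∑<-+ : ∀ m g h → ∑< m (λ i → g i + h i) ≡ ∑< m g + ∑< m h
  ∑<-+ zero    g h = refl
  ∑<-+ (suc m) g h = trans (cong (_+ (g m + h m)) (∑<-+ m g h))
      (interchange (∑< m g) (∑< m h) (g m) (h m))
    where
    interchange : ∀ a b c d → a + b + (c + d) ≡ a + c + (b + d)
    interchange = solve-∀

  ∑<-bound : ∀ m c {g} → (∀ i → g i ≤ c) → ∑< m g ≤ m * c
  ∑<-bound zero    c g≤c = z≤n
  ∑<-bound (suc m) c g≤c = ≤-trans (+-mono-≤ (∑<-bound m c g≤c) (g≤c m))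
      (≤-reflexive (+-comm (m * c) c))

  -- The first K terms, where g and h are not compared, cost at most c each.
  ∑<-eventually-mono : ∀ m K c {g h} → (∀ i → g i ≤ c) → (∀ i → K ≤ i → g i ≤ h i) →
                       ∑< m g ≤ ∑< m h + K * c
  ∑<-eventually-mono zero    K c g≤c g≤h = z≤n
  ∑<-eventually-mono (suc m) K c {g} {h} g≤c g≤h with K ≤? m
  ... | yes K≤m = ≤-trans (+-mono-≤ (∑<-eventually-mono m K c g≤c g≤h) (g≤h m K≤m))
                    (≤-reflexive (swap (∑< m h) (K * c) (h m)))
    where
    swap : ∀ a b c → a + b + c ≡ a + c + b
    swap = solve-∀
  ... | no  K≰m = ≤-trans (∑<-bound (suc m) c g≤c)
      (≤-trans (*-monoˡ-≤ c (≰⇒> K≰m)) (m≤n+m (K * c) (∑< (suc m) h)))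

  indicator : ∀ {A : Set} → Dec A → ℕ
  indicator (yes _) = 1
  indicator (no _)  = 0

  indicator≤1 : ∀ {A : Set} (A? : Dec A) → indicator A? ≤ 1
  indicator≤1 (yes _) = ≤-refl
  indicator≤1 (no _)  = z≤n

  indicator-yes : ∀ {A : Set} (A? : Dec A) → A → indicator A? ≡ 1
  indicator-yes (yes _) _ = refl
  indicator-yes (no ¬a) a = contradiction a ¬a

  indicator-no : ∀ {A : Set} (A? : Dec A) → ¬ A → indicator A? ≡ 0
  indicator-no (yes a) ¬a = contradiction a ¬a
  indicator-no (no _)  _  = refl

  count : ∀ {P : Pred ℕ 0ℓ} → Decidable P → ℕ → ℕ
  count P? m = ∑< m (λ n → indicator (P? n))

  length-filter-upTo : ∀ {P : Pred ℕ 0ℓ} (P? : Decidable P) m →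
      length (filter P? (upTo m)) ≡ count P? m
  length-filter-upTo P? zero = refl
  length-filter-upTo P? (suc m) = begin
    length (filter P? (upTo (suc m)))                      ≡⟨ cong (λ ns → length (filter P? ns))
        (upTo-∷ʳ m) ⟨
    length (filter P? (upTo m ++ [ m ]))                   ≡⟨ cong length
        (filter-++ P? (upTo m) [ m ]) ⟩
    length (filter P? (upTo m) ++ filter P? [ m ])         ≡⟨ length-++ (filter P? (upTo m)) ⟩
    length (filter P? (upTo m)) + length (filter P? [ m ])
        ≡⟨ cong₂ _+_ (length-filter-upTo P? m) last ⟩
    count P? m + indicator (P? m)                          ∎
    where
    open ≡-Reasoning
    last : length (filter P? [ m ]) ≡ indicator (P? m)
    last with P? m
    ... | yes _ = refl
    ... | no _  = refl

  count-all : ∀ {P : Pred ℕ 0ℓ} (P? : Decidable P) → (∀ n → P n) → ∀ m → count P? m ≡ m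
  count-all P? all zero    = refl
  count-all P? all (suc m) = trans (cong₂ _+_ (count-all P? all m) (indicator-yes (P? m) (all m)))
      (+-comm m 1)

  count≤ : ∀ {P : Pred ℕ 0ℓ} (P? : Decidable P) m → count P? m ≤ m
  count≤ P? m = ≤-trans (∑<-bound m 1 (λ n → indicator≤1 (P? n))) (≤-reflexive (*-identityʳ m))

  -- The points position n = offset n / (1 + block n) of [0,1) are equidistributed:
  -- n ranges over the blocks 0; 0, 1/2; 0, 1/3, 2/3; ...

  position-below : ℕ → ℕ → ℕ → Set
  position-below u v n = offset n * v < u * suc (block n)

  position-below? : ∀ u v → Decidable (position-below u v)
  position-below? u v n = offset n * v <? u * suc (block n)

  module Equidistribution {u v : ℕ} (u≤v : u ≤ v) where

    N : ℕ → ℕ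
    N = count (position-below? u v)

    -- `before` counts the hits in the k finished blocks, `hits` those among the first j offsets of
    -- the current one. A finished block of length k + 1 contributes between u(k + 1)/v and one
    -- more, whence the error v * k. The final alternative records that hits form an initial
    -- segment: either every offset so far was a hit, or the lower bound for the block is already
    -- reached.
    Invariant : ℕ → ℕ → ℕ → Set
    Invariant k j total = Σ[ before ∈ ℕ ] Σ[ hits ∈ ℕ ]
      (total ≡ before + hits
      × u * triangle k ≤ v * before × v * before ≤ u * triangle k + v * k
      × hits ≤ j × v * hits ≤ u * suc k + v × (hits ≡ j ⊎ u * suc k ≤ v * hits))

    advance : ∀ {k j total} (A? : Dec (j * v < u * suc k)) → Invariant k j total →
        Invariant k (suc j) (total + indicator A?)
    advance {k} {j} (yes hit) (b , h , eq , lo , hi , h≤j , vh≤ , alt) =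
      b , suc h , trans (+-comm _ 1) (trans (cong suc eq) (sym (+-suc b h))) , lo , hi , s≤s h≤j ,
      ≤-trans (≤-reflexive (trans (*-suc v h) (+-comm v (v * h))))
        (+-monoˡ-≤ v (≤-trans (*-monoʳ-≤ v h≤j) (≤-trans (≤-reflexive (*-comm v j)) (<⇒≤ hit)))) ,
      [ (λ h≡j → inj₁ (cong suc h≡j)) , (λ le → inj₂ (≤-trans le (*-monoʳ-≤ v (n≤1+n h)))) ]′ alt
    advance {k} {j} (no miss) (b , h , eq , lo , hi , h≤j , vh≤ , alt) =
      b , h , trans (+-identityʳ _) eq , lo , hi , m≤n⇒m≤1+n h≤j , vh≤ ,
      inj₂ ([ (λ { refl → ≤-trans (≮⇒≥ miss) (≤-reflexive (*-comm h v)) }) , (λ le → le) ]′ alt)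

    close : ∀ {k total} → Invariant k (suc k) total → Invariant (suc k) 0 total
    close {k} (b , h , refl , lo , hi , _ , vh≤ , alt) =
      b + h , 0 , sym (+-identityʳ _) ,
      ≤-trans (≤-reflexive (*-distribˡ-+ u (triangle k) (suc k)))
          (≤-trans (+-mono-≤ lo full) (≤-reflexive (sym (*-distribˡ-+ v b h)))) ,
      ≤-trans (≤-reflexive (*-distribˡ-+ v b h))
          (≤-trans (+-mono-≤ hi vh≤) (≤-reflexive (regroup u v (triangle k) k))) ,
      z≤n , ≤-trans (≤-reflexive (*-zeroʳ v)) z≤n , inj₁ refl
      where
      full : u * suc k ≤ v * h
      full = [ (λ { refl → *-monoˡ-≤ (suc k) u≤v }) , (λ le → le) ]′ alt
      regroup : ∀ u v t k → u * t + v * k + (u * suc k + v) ≡ u * (t + suc k) + v * suc k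
      regroup = solve-∀

    invariant : ∀ m → Invariant (block m) (offset m) (N m)
    invariant zero = 0 , 0 , refl , ≤-reflexive (trans (*-zeroʳ u) (sym (*-zeroʳ v))) ,
        ≤-trans (≤-reflexive (*-zeroʳ v)) z≤n ,
                     z≤n , ≤-trans (≤-reflexive (*-zeroʳ v)) z≤n , inj₁ refl
    invariant (suc m) with proj₂ (proj₂ (unpair-spec m)) | advance (position-below? u v m)
        (invariant m)
    ... | inside _ b≡ o≡ | inv rewrite b≡ | o≡ = inv
    ... | jump o≡b b≡ o≡ | inv rewrite b≡ | o≡ = close
        (subst (λ j → Invariant (block m) (suc j) (N (suc m))) o≡b inv)

    -- One v * block m pays for rounding in the finished blocks, the other for the unfinished block.
    error : ℕ → ℕ
    error m = v * (2 * block m)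

    bounds : ∀ m → u * m ≤ v * N m + error m × v * N m ≤ u * m + error m
    bounds m with unpair-spec m | invariant m
    ... | eq , o≤b , _ | b , h , N≡ , lo , hi , h≤j , vh≤ , _ =
      subst₂ (λ z w → u * z ≤ v * w + error m) eq (sym N≡) lower ,
      subst₂ (λ z w → v * w ≤ u * z + error m) eq (sym N≡) upper
      where
      k = block m
      j = offset m
      lower : u * (triangle k + j) ≤ v * (b + h) + error m
      lower = begin
        u * (triangle k + j)    ≡⟨ *-distribˡ-+ u (triangle k) j ⟩
        u * triangle k + u * j  ≤⟨ +-mono-≤ lo (*-mono-≤ u≤v (≤-trans o≤b (m≤m+n k (k + 0)))) ⟩
        v * b + v * (2 * k)     ≤⟨ +-monoˡ-≤ _ (*-monoʳ-≤ v (m≤m+n b h)) ⟩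
        v * (b + h) + error m   ∎
        where open ≤-Reasoning
      upper : v * (b + h) ≤ u * (triangle k + j) + error m
      upper = begin
        v * (b + h)                         ≡⟨ *-distribˡ-+ v b h ⟩
        v * b + v * h                       ≤⟨ +-mono-≤ hi (*-monoʳ-≤ v (≤-trans h≤j o≤b)) ⟩
        u * triangle k + v * k + v * k      ≡⟨ regroup (u * triangle k) v k ⟩
        u * triangle k + v * (2 * k)        ≤⟨ +-monoˡ-≤ (error m)
            (*-monoʳ-≤ u (m≤m+n (triangle k) j)) ⟩
        u * (triangle k + j) + error m      ∎
        where
        open ≤-Reasoning
        regroup : ∀ a v k → a + v * k + v * k ≡ a + v * (2 * k)
        regroup = solve-∀

  triangle-mono : ∀ {k l} → k ≤ l → triangle k ≤ triangle l
  triangle-mono z≤n       = z≤n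
  triangle-mono (s≤s k≤l) = +-mono-≤ (triangle-mono k≤l) (s≤s k≤l)

  triangle-doubled : ∀ k → 2 * triangle k ≡ k * suc k
  triangle-doubled zero = refl
  triangle-doubled (suc k) = trans (*-distribˡ-+ 2 (triangle k) (suc k))
      (trans (cong (_+ 2 * suc k) (triangle-doubled k)) (regroup k))
    where
    regroup : ∀ k → k * suc k + 2 * suc k ≡ suc k * suc (suc k)
    regroup = solve-∀

  -- Blocks grow like the square root: m is at least b(b + 1)/2 for b = `block m`, which exceeds C(b
  -- + 1) once b ≥ 2C. For smaller b the threshold on m suffices.
  block-sublinear : ∀ C → ∃[ m₀ ] (∀ m → m₀ ≤ m → C * suc (block m) ≤ m)
  block-sublinear C = C * suc (2 * C) , bound
    where
    bound : ∀ m → C * suc (2 * C) ≤ m → C * suc (block m) ≤ m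
    bound m m₀≤m with ≤-total (block m) (2 * C)
    ... | inj₁ b≤2C = ≤-trans (*-monoʳ-≤ C (s≤s b≤2C)) m₀≤m
    ... | inj₂ 2C≤b = ≤-trans (*-cancelˡ-≤ 2 doubled)
        (subst (triangle (block m) ≤_) (proj₁ (unpair-spec m)) (m≤m+n _ _))
      where
      doubled : 2 * (C * suc (block m)) ≤ 2 * triangle (block m)
      doubled = begin
        2 * (C * suc (block m))   ≡⟨ *-assoc 2 C _ ⟨
        2 * C * suc (block m)     ≤⟨ *-monoˡ-≤ (suc (block m)) 2C≤b ⟩
        block m * suc (block m)   ≡⟨ triangle-doubled (block m) ⟨
        2 * triangle (block m)    ∎
        where open ≤-Reasoning

  -- If X eventually agrees with { n : j/M ≤ position n < i/M } up to one grid cell on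
  -- either side, then its density is (i - j)/M up to 2/M.
  module _ {X : Pred ℕ 0ℓ} (X? : Decidable X) {M i j : ℕ} (i<M : i < M) (j<M : j < M) (K : ℕ)
    (upper : ∀ n → K ≤ n → indicator (X? n) + indicator (position-below? j M n) ≤
        indicator (position-below? (suc i) M n))
    (lower : ∀ n → K ≤ n → indicator (position-below? i M n) ≤ indicator (X? n) +
        indicator (position-below? (suc j) M n))
    where

    private
      -- Chosen so that both equidistribution errors and the 2K lost at the start together stay
      -- below m, that is, below one grid cell of density.
      C : ℕ
      C = 4 * M + 2 * (M * K)

      slack : ∀ {m} → C * suc (block m) ≤ m →
          M * (2 * block m) + (M * (K * 2) + M * (2 * block m)) ≤ m
      slack {m} small = ≤-trans
          (≤-trans (m≤m+n _ (4 * M + 2 * (M * K) * block m))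
          (≤-reflexive (regroup M K (block m)))) small
        where
        regroup : ∀ M K b → M * (2 * b) + (M * (K * 2) + M * (2 * b)) + (4 * M + 2 * (M * K) * b)
            ≡ (4 * M + 2 * (M * K)) * suc b
        regroup = solve-∀

    grid-density : ∃[ m₀ ] (∀ m → m₀ ≤ m →
      M * count X? m + j * m ≤ (2 + i) * m × i * m ≤ M * count X? m + (2 + j) * m)
    grid-density = proj₁ (block-sublinear C) , λ m m₀≤m →
        up m (slack (proj₂ (block-sublinear C) m m₀≤m)) ,
        down m (slack (proj₂ (block-sublinear C) m m₀≤m))
      where
      open ≤-Reasoning
      module _ {u} (u≤M : u ≤ M) where open Equidistribution u≤M public
      up : ∀ m → _ → M * count X? m + j * m ≤ (2 + i) * m
      up m small = begin
        M * x + j * m                                     ≤⟨ +-monoʳ-≤ (M * x)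
            (proj₁ (bounds (<⇒≤ j<M) m)) ⟩
        M * x + (M * y + e)                               ≡⟨ r₁ M x y e ⟩
        M * (x + y) + e                                   ≤⟨ +-monoˡ-≤ e (*-monoʳ-≤ M sub) ⟩
        M * (z + K * 2) + e                               ≡⟨ r₂ M z (K * 2) e ⟩
        M * z + (M * (K * 2) + e)                         ≤⟨ +-monoˡ-≤ (M * (K * 2) + e)
            (proj₂ (bounds i<M m)) ⟩
        suc i * m + e + (M * (K * 2) + e)                 ≡⟨ +-assoc (suc i * m) e _ ⟩
        suc i * m + (e + (M * (K * 2) + e))               ≤⟨ +-monoʳ-≤ (suc i * m) small ⟩
        suc i * m + m                                     ≡⟨ +-comm (suc i * m) m ⟩
        (2 + i) * m                                       ∎
        where
        x = count X? m
        y = count (position-below? j M) m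
        z = count (position-below? (suc i) M) m
        e = M * (2 * block m)
        r₁ : ∀ M x y e → M * x + (M * y + e) ≡ M * (x + y) + e
        r₁ = solve-∀
        r₂ : ∀ M z k e → M * (z + k) + e ≡ M * z + (M * k + e)
        r₂ = solve-∀
        sub : x + y ≤ z + K * 2
        sub = ≤-trans (≤-reflexive (sym (∑<-+ m _ _)))
          (∑<-eventually-mono m K 2
              (λ n → +-mono-≤ (indicator≤1 (X? n)) (indicator≤1 (position-below? j M n))) upper)
      down : ∀ m → _ → i * m ≤ M * count X? m + (2 + j) * m
      down m small = begin
        i * m                                             ≤⟨ proj₁ (bounds (<⇒≤ i<M) m) ⟩
        M * y + e                                         ≤⟨ +-monoˡ-≤ e (*-monoʳ-≤ M sub) ⟩
        M * (x + z + K * 2) + e                           ≡⟨ r M x z (K * 2) e ⟩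
        M * x + (M * z + (M * (K * 2) + e))               ≤⟨ +-monoʳ-≤ (M * x)
            (+-monoˡ-≤ (M * (K * 2) + e) (proj₂ (bounds j<M m))) ⟩
        M * x + (suc j * m + e + (M * (K * 2) + e))       ≡⟨ cong (M * x +_)
            (+-assoc (suc j * m) e _) ⟩
        M * x + (suc j * m + (e + (M * (K * 2) + e)))     ≤⟨ +-monoʳ-≤ (M * x)
            (+-monoʳ-≤ (suc j * m) small) ⟩
        M * x + (suc j * m + m)                           ≡⟨ cong (M * x +_)
            (+-comm (suc j * m) m) ⟩
        M * x + (2 + j) * m                               ∎
        where
        x = count X? m
        y = count (position-below? i M) m
        z = count (position-below? (suc j) M) m
        e = M * (2 * block m)
        r : ∀ M x z k e → M * (x + z + k) + e ≡ M * x + (M * z + (M * k + e))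
        r = solve-∀
        sub : y ≤ x + z + K * 2
        sub = ≤-trans (∑<-eventually-mono m K 2
            (λ n → ≤-trans (indicator≤1 (position-below? i M n)) (n≤1+n 1)) lower)
          (+-monoˡ-≤ (K * 2) (≤-reflexive (∑<-+ m _ _)))

open Arithmetic
open import Data.Integer as ℤ using (ℤ; +_; -[1+_]; _⊖_)
import Data.Integer.Properties as ℤ
import Data.Integer.Tactic.RingSolver as ℤ
open import Data.Rational
open import Data.Rational.Properties
open import Data.Rational.Solver using (module +-*-Solver)
import Data.Rational.Unnormalised as ℚᵘ
import Data.Rational.Unnormalised.Properties as ℚᵘ

-- Comparing and adding coded rationals by arithmetic on naturals.

toℚᵘ-/ : ∀ i m → toℚᵘ (i / suc m) ℚᵘ.≃ ℚᵘ.mkℚᵘ i m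
toℚᵘ-/ i m = toℚᵘ-fromℚᵘ (ℚᵘ.mkℚᵘ i m)

module _ (a b c d m n : ℕ) where
  private
    -- Added to both sides of a cross-multiplied inequality, this cancels the negative parts and
    -- leaves natural numbers, on which recursive functions can act.
    offsetℤ : ℤ
    offsetℤ = + (b ℕ.* suc n ℕ.+ d ℕ.* suc m)

    lhs : (a ⊖ b) ℤ.* + suc n ℤ.+ offsetℤ ≡ + (a ℕ.* suc n ℕ.+ d ℕ.* suc m)
    lhs = trans (cong₂ (λ x y → x ℤ.* + suc n ℤ.+ y) (sym (ℤ.m-n≡m⊖n a b))
                  (trans (ℤ.pos-+ (b ℕ.* suc n) _)
                      (cong₂ ℤ._+_ (ℤ.pos-* b (suc n)) (ℤ.pos-* d (suc m)))))
         (trans (cancel (+ a) (+ b) (+ suc n) (+ d ℤ.* + suc m))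
         (sym (trans (ℤ.pos-+ (a ℕ.* suc n) _)
             (cong₂ ℤ._+_ (ℤ.pos-* a (suc n)) (ℤ.pos-* d (suc m))))))
      where
      cancel : ∀ a b n e → (a ℤ.- b) ℤ.* n ℤ.+ (b ℤ.* n ℤ.+ e) ≡ a ℤ.* n ℤ.+ e
      cancel = ℤ.solve-∀

    rhs : (c ⊖ d) ℤ.* + suc m ℤ.+ offsetℤ ≡ + (c ℕ.* suc m ℕ.+ b ℕ.* suc n)
    rhs = trans (cong₂ (λ x y → x ℤ.* + suc m ℤ.+ y) (sym (ℤ.m-n≡m⊖n c d))
                  (trans (ℤ.pos-+ (b ℕ.* suc n) _)
                      (cong₂ ℤ._+_ (ℤ.pos-* b (suc n)) (ℤ.pos-* d (suc m)))))
         (trans (cancel (+ c) (+ d) (+ suc m) (+ b ℤ.* + suc n))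
         (sym (trans (ℤ.pos-+ (c ℕ.* suc m) _)
             (cong₂ ℤ._+_ (ℤ.pos-* c (suc m)) (ℤ.pos-* b (suc n))))))
      where
      cancel : ∀ c d m e → (c ℤ.- d) ℤ.* m ℤ.+ (e ℤ.+ d ℤ.* m) ≡ c ℤ.* m ℤ.+ e
      cancel = ℤ.solve-∀

  /-≤ : (a ⊖ b) / suc m ≤ (c ⊖ d) / suc n ⇔
      a ℕ.* suc n ℕ.+ d ℕ.* suc m ℕ.≤ c ℕ.* suc m ℕ.+ b ℕ.* suc n
  /-≤ = mk⇔
    (λ p≤q → ℤ.drop‿+≤+ (subst₂ ℤ._≤_ lhs rhs (ℤ.+-monoˡ-≤ offsetℤ (ℚᵘ.drop-*≤*
      (ℚᵘ.≤-respˡ-≃ (toℚᵘ-/ (a ⊖ b) m) (ℚᵘ.≤-respʳ-≃ (toℚᵘ-/ (c ⊖ d) n) (toℚᵘ-mono-≤ p≤q)))))))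
    (λ le → toℚᵘ-cancel-≤ (ℚᵘ.≤-respˡ-≃ (ℚᵘ.≃-sym (toℚᵘ-/ (a ⊖ b) m))
        (ℚᵘ.≤-respʳ-≃ (ℚᵘ.≃-sym (toℚᵘ-/ (c ⊖ d) n))
      (ℚᵘ.*≤* (cancelʳ-≤ offsetℤ (subst₂ ℤ._≤_ (sym lhs) (sym rhs) (ℤ.+≤+ le)))))))
    where
    cancelʳ-≤ : ∀ {i j} k → i ℤ.+ k ℤ.≤ j ℤ.+ k → i ℤ.≤ j
    cancelʳ-≤ {i} {j} k = ℤ.≮⇒≥ ∘ λ le j<i → ℤ.<⇒≱ (ℤ.+-monoˡ-< k j<i) le

  /-< : (a ⊖ b) / suc m < (c ⊖ d) / suc n ⇔
      a ℕ.* suc n ℕ.+ d ℕ.* suc m ℕ.< c ℕ.* suc m ℕ.+ b ℕ.* suc n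
  /-< = mk⇔
    (λ p<q → ℤ.drop‿+<+ (subst₂ ℤ._<_ lhs rhs (ℤ.+-monoˡ-< offsetℤ (ℚᵘ.drop-*<*
      (ℚᵘ.<-respˡ-≃ (toℚᵘ-/ (a ⊖ b) m) (ℚᵘ.<-respʳ-≃ (toℚᵘ-/ (c ⊖ d) n) (toℚᵘ-mono-< p<q)))))))
    (λ lt → toℚᵘ-cancel-< (ℚᵘ.<-respˡ-≃ (ℚᵘ.≃-sym (toℚᵘ-/ (a ⊖ b) m))
        (ℚᵘ.<-respʳ-≃ (ℚᵘ.≃-sym (toℚᵘ-/ (c ⊖ d) n))
      (ℚᵘ.*<* (cancelʳ-< offsetℤ (subst₂ ℤ._<_ (sym lhs) (sym rhs) (ℤ.+<+ lt)))))))
    where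
    cancelʳ-< : ∀ {i j} k → i ℤ.+ k ℤ.< j ℤ.+ k → i ℤ.< j
    cancelʳ-< {i} {j} k = ℤ.≰⇒> ∘ λ lt j≤i → ℤ.<⇒≱ lt (ℤ.+-monoˡ-≤ k j≤i)

  /-+ : (a ⊖ b) / suc m + (c ⊖ d) / suc n ≡
        ((a ℕ.* suc n ℕ.+ c ℕ.* suc m) ⊖ (b ℕ.* suc n ℕ.+ d ℕ.* suc m)) / (suc m ℕ.* suc n)
  /-+ = toℚᵘ-injective (ℚᵘ.≃-trans (toℚᵘ-homo-+ ((a ⊖ b) / suc m) ((c ⊖ d) / suc n))
    (ℚᵘ.≃-trans (ℚᵘ.+-cong (toℚᵘ-/ (a ⊖ b) m) (toℚᵘ-/ (c ⊖ d) n))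
    (ℚᵘ.≃-sym (ℚᵘ.≃-trans (toℚᵘ-/ _ _)
        (ℚᵘ.≃-reflexive (cong (λ i → ℚᵘ.mkℚᵘ i (n ℕ.+ m ℕ.* suc n)) numerator))))))
    where
    expand : ∀ a b c d m n → (a ℤ.* n ℤ.+ c ℤ.* m) ℤ.- (b ℤ.* n ℤ.+ d ℤ.* m) ≡ (a ℤ.- b) ℤ.* n ℤ.+
        (c ℤ.- d) ℤ.* m
    expand = ℤ.solve-∀
    cast : ∀ a c → + (a ℕ.* suc n ℕ.+ c ℕ.* suc m) ≡ + a ℤ.* + suc n ℤ.+ + c ℤ.* + suc m
    cast a c = trans (ℤ.pos-+ (a ℕ.* suc n) _) (cong₂ ℤ._+_ (ℤ.pos-* a (suc n)) (ℤ.pos-* c (suc m)))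
    numerator : (a ℕ.* suc n ℕ.+ c ℕ.* suc m) ⊖ (b ℕ.* suc n ℕ.+ d ℕ.* suc m) ≡
                (a ⊖ b) ℤ.* + suc n ℤ.+ (c ⊖ d) ℤ.* + suc m
    numerator = trans (sym (ℤ.m-n≡m⊖n (a ℕ.* suc n ℕ.+ c ℕ.* suc m) (b ℕ.* suc n ℕ.+ d ℕ.* suc m)))
      (trans (cong₂ ℤ._-_ (cast a c) (cast b d))
      (trans (expand (+ a) (+ b) (+ c) (+ d) (+ suc m) (+ suc n))
        (cong₂ (λ x y → x ℤ.* + suc n ℤ.+ y ℤ.* + suc m) (ℤ.m-n≡m⊖n a b) (ℤ.m-n≡m⊖n c d))))

decodeℚ-surjective : ∀ q → ∃[ a ] ∃[ b ] ∃[ c ] decodeℚ (a ∷ b ∷ c ∷ []) ≡ q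
decodeℚ-surjective q@(mkℚ (+ n) d _)    = n , 0 , d , ↥p/↧p≡p q
decodeℚ-surjective q@(mkℚ -[1+ n ] d _) = 0 , suc n , d , ↥p/↧p≡p q

infix 8 _⁄_

opaque
  -- The denominator is v + 1, so it never vanishes. Opacity confines the reduction to lowest terms
  -- to this block; elsewhere fractions are handled by cross-multiplication.
  _⁄_ : ℕ → ℕ → ℚ
  u ⁄ v = + u / suc v

  ⁄-def : ∀ u v → u ⁄ v ≡ + u / suc v
  ⁄-def u v = refl

  ⁄-≤ : ∀ {a m b n} → a ⁄ m ≤ b ⁄ n ⇔ a ℕ.* suc n ℕ.≤ b ℕ.* suc m
  ⁄-≤ {a} {m} {b} {n} = subst₂ (λ x y → a ⁄ m ≤ b ⁄ n ⇔ x ℕ.≤ y) (ℕ.+-identityʳ _)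
      (ℕ.+-identityʳ _) (/-≤ a 0 b 0 m n)

  ⁄-< : ∀ {a m b n} → a ⁄ m < b ⁄ n ⇔ a ℕ.* suc n ℕ.< b ℕ.* suc m
  ⁄-< {a} {m} {b} {n} = subst₂ (λ x y → a ⁄ m < b ⁄ n ⇔ x ℕ.< y) (ℕ.+-identityʳ _)
      (ℕ.+-identityʳ _) (/-< a 0 b 0 m n)

  ⁄-+ : ∀ a m b n → a ⁄ m + b ⁄ n ≡ (a ℕ.* suc n ℕ.+ b ℕ.* suc m) ⁄ (n ℕ.+ m ℕ.* suc n)
  ⁄-+ a m b n = /-+ a 0 b 0 m n

  decodeℚ-≤-⁄ : ∀ a b c {u v} → decodeℚ (a ∷ b ∷ c ∷ []) ≤ u ⁄ v ⇔
      a ℕ.* suc v ℕ.≤ u ℕ.* suc c ℕ.+ b ℕ.* suc v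
  decodeℚ-≤-⁄ a b c {u} {v} =
    subst (λ x → decodeℚ (a ∷ b ∷ c ∷ []) ≤ u ⁄ v ⇔ x ℕ.≤ u ℕ.* suc c ℕ.+ b ℕ.* suc v)
        (ℕ.+-identityʳ _) (/-≤ a b u 0 c v)

  ⁄-≤-decodeℚ : ∀ a b c {u v} → u ⁄ v ≤ decodeℚ (a ∷ b ∷ c ∷ []) ⇔
      u ℕ.* suc c ℕ.+ b ℕ.* suc v ℕ.≤ a ℕ.* suc v
  ⁄-≤-decodeℚ a b c {u} {v} =
    subst (λ x → u ⁄ v ≤ decodeℚ (a ∷ b ∷ c ∷ []) ⇔ u ℕ.* suc c ℕ.+ b ℕ.* suc v ℕ.≤ x)
        (ℕ.+-identityʳ _) (/-≤ u 0 a b v c)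

  decodeℚ-+-⁄ : ∀ a b c u v → decodeℚ (a ∷ b ∷ c ∷ []) + u ⁄ v ≡
                decodeℚ (a ℕ.* suc v ℕ.+ u ℕ.* suc c ∷ b ℕ.* suc v ∷ v ℕ.+ c ℕ.* suc v ∷ [])
  decodeℚ-+-⁄ a b c u v =
    trans (/-+ a b u 0 c v) (cong
        (λ x → decodeℚ (a ℕ.* suc v ℕ.+ u ℕ.* suc c ∷ x ∷ v ℕ.+ c ℕ.* suc v ∷ []))
        (ℕ.+-identityʳ (b ℕ.* suc v)))

  0⁄0≡0 : 0 ⁄ 0 ≡ 0ℚ
  0⁄0≡0 = refl

  1⁄0≡1 : 1 ⁄ 0 ≡ 1ℚ
  1⁄0≡1 = refl

⁄-cong : ∀ {a m b n} → a ℕ.* suc n ≡ b ℕ.* suc m → a ⁄ m ≡ b ⁄ n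
⁄-cong eq = ≤-antisym (from ⁄-≤ (ℕ.≤-reflexive eq)) (from ⁄-≤ (ℕ.≤-reflexive (sym eq)))

⁄-+-same : ∀ a b m → (a ℕ.+ b) ⁄ m ≡ a ⁄ m + b ⁄ m
⁄-+-same a b m = trans (⁄-cong (regroup a b (suc m))) (sym (⁄-+ a m b m))
  where
  regroup : ∀ a b k → (a ℕ.+ b) ℕ.* (k ℕ.* k) ≡ (a ℕ.* k ℕ.+ b ℕ.* k) ℕ.* k
  regroup = ℕ.solve-∀

0⁄ : ∀ m → 0 ⁄ m ≡ 0ℚ
0⁄ m = trans (⁄-cong refl) 0⁄0≡0

n⁄n : ∀ m → suc m ⁄ m ≡ 1ℚ
n⁄n m = trans (⁄-cong (trans (ℕ.*-identityʳ _) (sym (ℕ.*-identityˡ _)))) 1⁄0≡1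

0≤⁄ : ∀ u v → 0ℚ ≤ u ⁄ v
0≤⁄ u v = subst (_≤ u ⁄ v) (0⁄ v) (from ⁄-≤ ℕ.z≤n)

-- A positive fraction has numerator at least 1, so its own denominator serves.
ε-unit : ∀ {ε} → 0ℚ < ε → ∃[ c ] 1 ⁄ c ≤ ε
ε-unit {ε} 0<ε with decodeℚ-surjective ε
... | a , b , c , refl = c , from (⁄-≤-decodeℚ a b c)
  (ℕ.≤-trans (ℕ.≤-reflexive (cong (ℕ._+ b ℕ.* suc c) (ℕ.*-identityˡ (suc c))))
      (ℕ.*-monoˡ-≤ (suc c) b<a))
  where
  b<a : b ℕ.< a
  b<a = subst₂ ℕ._<_ (ℕ.*-identityʳ b) (trans (ℕ.+-identityʳ _) (ℕ.*-identityʳ a))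
      (to (/-< 0 0 a b 0 c) 0<ε)

p<q-r : ∀ {p q r} → p + r < q → p < q - r
p<q-r {p} {q} {r} lt = subst (_< q - r) (lemma p r) (+-monoˡ-< (- r) lt)
  where
  open +-*-Solver
  lemma : ∀ p r → p + r - r ≡ p
  lemma = solve 2 (λ p r → p :+ r :- r := p) refl

p+r<q : ∀ {p q r} → p < q - r → p + r < q
p+r<q {p} {q} {r} lt = subst (p + r <_) (lemma q r) (+-monoˡ-< r lt)
  where
  open +-*-Solver
  lemma : ∀ q r → q - r + r ≡ q
  lemma = solve 2 (λ q r → q :- r :+ r := q) refl

0<q-p : ∀ {p q} → p < q → 0ℚ < q - p
0<q-p {p} {q} p<q = p<q-r {0ℚ} {q} {p} (subst (_< q) (sym (+-identityˡ p)) p<q)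

p-ε<p : ∀ p {ε} → 0ℚ < ε → p - ε < p
p-ε<p p {ε} 0<ε = subst (p - ε <_) (+-identityʳ p) (+-monoʳ-< p (neg-antimono-< 0<ε))

p<p+ε : ∀ p {ε} → 0ℚ < ε → p < p + ε
p<p+ε p {ε} 0<ε = subst (_< p + ε) (+-identityʳ p) (+-monoʳ-< p 0<ε)

downward-≤ : ∀ (a : ℝ) {p q} → p ≤ q → q ∈ cut a → p ∈ cut a
downward-≤ a {p} {q} p≤q q∈a with <-cmp p q
... | tri< p<q _ _  = downward a p<q q∈a
... | tri≈ _ refl _ = q∈a
... | tri> _ _ q<p  = contradiction (<-≤-trans q<p p≤q) (<-irrefl refl)

∈-∉⇒< : ∀ (a : ℝ) {p q} → p ∈ cut a → q ∉ cut a → p < q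
∈-∉⇒< a p∈a q∉a = ≰⇒> λ q≤p → q∉a (downward-≤ a q≤p p∈a)

fromℚ<⇒∈ : ∀ (r : ℝ) {p} → fromℚ p <ᵣ r → p ∈ cut r
fromℚ<⇒∈ r (x , x≮p , x∈r) = downward-≤ r (≮⇒≥ x≮p) x∈r

<fromℚ⇒∉ : ∀ (r : ℝ) {p} → r <ᵣ fromℚ p → p ∉ cut r
<fromℚ⇒∉ r (x , x∉r , x<p) p∈r = x∉r (downward r x<p p∈r)

∈⇒fromℚ< : ∀ (r : ℝ) {p} → p ∈ cut r → fromℚ p <ᵣ r
∈⇒fromℚ< r p∈r = _ , <-irrefl refl , p∈r

-- Classical search and approximation of cuts.

module Classical (em : ExcludedMiddle 0ℓ) where

  by-contradiction : ∀ {A : Set} → ¬ ¬ A → A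
  by-contradiction {A} ¬¬a with em {A}
  ... | yes a = a
  ... | no ¬a = contradiction ¬a ¬¬a

  last-before : ∀ (P : Pred ℕ 0ℓ) M → P 0 → ¬ P M → ∃[ i ] (i ℕ.< M × P i × ¬ P (suc i))
  last-before P zero    p₀ ¬pM = contradiction p₀ ¬pM
  last-before P (suc M) p₀ ¬pM with em {P M}
  ... | yes pM = M , ℕ.≤-refl , pM , ¬pM
  ... | no ¬p  = let i , i<M , pi , ¬p+1 = last-before P M p₀ ¬p in i , ℕ.m<n⇒m<1+n i<M , pi , ¬p+1

  archimedean : ∀ p d → ∃[ n ] p ≤ n ⁄ d
  archimedean p d =
    let a , b , c , eq = decodeℚ-surjective p in
    a ℕ.* suc d , subst (_≤ (a ℕ.* suc d) ⁄ d) eq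
      (from (decodeℚ-≤-⁄ a b c) (ℕ.≤-trans (ℕ.m≤m*n _ (suc c)) (ℕ.m≤m+n _ _)))

  -- Walk upwards from a point of the cut in steps 1/(d + 1) ≤ ε and stop at the last point still
  -- inside; the Archimedean property guarantees an exit.
  approximate : ∀ (a : ℝ) {ε} → 0ℚ < ε → ∃[ l ] (l ∈ cut a × l + ε ∉ cut a)
  approximate a {ε} 0<ε =
    let d , 1/d≤ε  = ε-unit 0<ε
        l , l∈a    = inhabited a
        u , u∉a    = proper a
        n , u-l≤   = archimedean (u - l) d
        i , _ , ∈a , ∉a = last-before (λ i → l + i ⁄ d ∈ cut a) n (first d l∈a)
            (beyond {l} {u} d n u∉a u-l≤)
    in l + i ⁄ d , ∈a , λ ∈a′ → ∉a (downward-≤ a (step l i d 1/d≤ε) ∈a′)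
    where
    first : ∀ {l} d → l ∈ cut a → l + 0 ⁄ d ∈ cut a
    first {l} d = subst (_∈ cut a) (sym (trans (cong (_+_ l) (0⁄ d)) (+-identityʳ l)))
    open +-*-Solver
    regroup : ∀ u l → l + (u - l) ≡ u
    regroup = solve 2 (λ u l → l :+ (u :- l) := u) refl
    beyond : ∀ {l u} d n → u ∉ cut a → u - l ≤ n ⁄ d → l + n ⁄ d ∉ cut a
    beyond {l} {u} d n u∉a le ∈a = u∉a
        (downward-≤ a (≤-trans (≤-reflexive (sym (regroup u l))) (+-monoʳ-≤ l le)) ∈a)
    step : ∀ l i d → 1 ⁄ d ≤ ε → l + suc i ⁄ d ≤ l + i ⁄ d + ε
    step l i d 1/d≤ε = ≤-trans (≤-reflexive (trans (cong (λ k → l + k ⁄ d) (ℕ.+-comm 1 i))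
             (trans (cong (_+_ l) (⁄-+-same i 1 d)) (sym (+-assoc l (i ⁄ d) (1 ⁄ d))))))
                 (+-monoʳ-≤ (l + i ⁄ d) 1/d≤ε)

-- Upper densities of c.e. sets.

ratio : ∀ {C : Pred ℕ 0ℓ} → Decidable C → ℕ → ℚ
ratio C? m = count C? (suc m) ⁄ m

ρ≡ratio : ∀ {C : Pred ℕ 0ℓ} (C? : Decidable C) m → ρ C? (suc m) ≡ ratio C? m
ρ≡ratio C? m = trans (cong (λ k → + k / suc m) (length-filter-upTo C? (suc m))) (sym (⁄-def _ m))

ratio≤1 : ∀ {C : Pred ℕ 0ℓ} (C? : Decidable C) m → ratio C? m ≤ 1ℚ
ratio≤1 C? m = subst (ratio C? m ≤_) (n⁄n m) (from ⁄-≤ (ℕ.*-monoˡ-≤ (suc m) (count≤ C? (suc m))))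

-- The lower cut of the upper density, except that the endpoint itself may belong to it.
Frequently : ∀ {C : Pred ℕ 0ℓ} → Decidable C → Pred ℚ 0ℓ
Frequently C? q = ∀ N → ∃[ m ] (N ℕ.≤ m × q ≤ ratio C? m)

frequently-downward : ∀ {C : Pred ℕ 0ℓ} (C? : Decidable C) {p q} →
                      p < q → q ∈ Frequently C? → p ∈ Frequently C?
frequently-downward C? p<q freq N = let m , N≤m , le = freq N in m , N≤m , ≤-trans (<⇒≤ p<q) le

fromℚ-leftΠ₂ : ∀ w → LeftΠ⁰₂ (fromℚ w)
fromℚ-leftΠ₂ w =
  let n , k , d , eq = decodeℚ-surjective w in subst (LeftΠ⁰₂ ∘ fromℚ) eq (rational n k d)
  where
  rational : ∀ n k d → LeftΠ⁰₂ (fromℚ (decodeℚ (n ∷ k ∷ d ∷ [])))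
  rational n k d = ∀Σ₁⇒Π₂ {Q = λ w → F w ≡ 0}
      (F ∘ tail , compᶜ cF (weakenᶜ idᶜ) , λ w → mk⇔ (0 ,_) proj₂) λ
    { (a ∷ b ∷ c ∷ []) → mk⇔
      (λ lt _ → ℕ.m≤n⇒m∸n≡0 (to (/-< a b n k c d) lt))
      (λ eq → from (/-< a b n k c d) (ℕ.m∸n≡0⇒m≤n (eq 0))) }
    where
    F : Vec ℕ 4 → ℕ
    F w = suc (lookup w 1F ℕ.* suc d ℕ.+ k ℕ.* suc (lookup w 3F)) ℕ.∸
        (n ℕ.* suc (lookup w 3F) ℕ.+ lookup w 2F ℕ.* suc d)
    cF : Computable F
    cF = sucᶜ (varᶜ 1F *ᶜ litᶜ (suc d) +ᶜ litᶜ k *ᶜ sucᶜ (varᶜ 3F)) ∸ᶜ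
        (litᶜ n *ᶜ sucᶜ (varᶜ 3F) +ᶜ varᶜ 2F *ᶜ litᶜ (suc d))

module _ {C : Pred ℕ 0ℓ} (C? : Decidable C) (C-Σ₁ : Σ₁ {1} (λ v → lookup v 0F ∈ C)) where
  private
    f : Vec ℕ 2 → ℕ
    f = proj₁ C-Σ₁

    C⇔ : ∀ x → C x ⇔ (∃[ y ] f (y ∷ x ∷ []) ≡ 0)
    C⇔ x = proj₂ (proj₂ C-Σ₁) (x ∷ [])

    -- The computable lower approximation to the count: only elements with a witness below s are
    -- seen.
    stage : ℕ → ℕ → ℕ
    stage s m = ∑< m (λ x → 1 ℕ.∸ ∏< s (λ y → f (y ∷ x ∷ [])))

    stage≤count : ∀ s m → stage s m ℕ.≤ count C? m
    stage≤count s m = ∑<-mono m λ x _ → pointwise x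
      where
      pointwise : ∀ x → 1 ℕ.∸ ∏< s (λ y → f (y ∷ x ∷ [])) ℕ.≤ indicator (C? x)
      pointwise x with C? x | ∏< s (λ y → f (y ∷ x ∷ [])) in eq
      ... | yes _  | p     = ℕ.m∸n≤m 1 p
      ... | no _   | suc p = ℕ.≤-reflexive (ℕ.0∸n≡0 p)
      ... | no x∉C | zero  = let y , _ , e = ∏<≡0⁻¹ s eq in contradiction (from (C⇔ x) (y , e)) x∉C

    count≤stage : ∀ m → ∃[ s ] count C? m ℕ.≤ stage s m
    count≤stage m = let s , found = bounded-choice m (λ x _ → witness x) in s , ∑<-mono m λ x x<m → pointwise s x (found x x<m)
      where
      witness : ∀ x → ∃[ y ] indicator (C? x) ℕ.* f (y ∷ x ∷ []) ≡ 0
      witness x with C? x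
      ... | yes x∈C = let y , eq = to (C⇔ x) x∈C in y , trans (ℕ.+-identityʳ _) eq
      ... | no _    = 0 , refl
      pointwise : ∀ s x → ∃[ y ] (y ℕ.< s × indicator (C? x) ℕ.* f (y ∷ x ∷ []) ≡ 0) →
                  indicator (C? x) ℕ.≤ 1 ℕ.∸ ∏< s (λ y → f (y ∷ x ∷ []))
      pointwise s x (y , y<s , eq) with C? x
      ... | yes _ = ℕ.≤-reflexive
          (sym (cong (1 ℕ.∸_) (∏<≡0 s y y<s (trans (sym (ℕ.+-identityʳ _)) eq))))
      ... | no _  = ℕ.z≤n

    -- Vanishes exactly when the rational coded by a, b, c is at most the stage-s ratio at index N +
    -- m; writing the index this way builds in the requirement that it be at least N.
    excess : ℕ → ℕ → ℕ → ℕ → ℕ → ℕ → ℕ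
    excess s m a b c N = a ℕ.* suc (N ℕ.+ m) ℕ.∸
        (stage s (suc (N ℕ.+ m)) ℕ.* suc c ℕ.+ b ℕ.* suc (N ℕ.+ m))

    F : Vec ℕ 5 → ℕ
    F w = excess (π₂ (lookup w 0F)) (π₁ (lookup w 0F)) (lookup w 2F) (lookup w 3F) (lookup w 4F)
        (lookup w 1F)

    cF : Computable F
    cF = varᶜ 2F *ᶜ cM ∸ᶜ (∑<ᶜ cM
        (litᶜ 1 ∸ᶜ ∏<ᶜ (compᶜ cs (weakenᶜ idᶜ))
        (compᶜ (proj₁ (proj₂ C-Σ₁)) (varᶜ 0F ∷ᶜ varᶜ 1F ∷ᶜ []ᶜ))) *ᶜ sucᶜ (varᶜ 4F) +ᶜ varᶜ 3F
        *ᶜ cM)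
      where
      cs : Computable {5} (λ w → π₂ (lookup w 0F))
      cs = blockᶜ (varᶜ 0F) ∸ᶜ offsetᶜ (varᶜ 0F)
      cM : Computable {5} (λ w → suc (lookup w 1F ℕ.+ π₁ (lookup w 0F)))
      cM = sucᶜ (varᶜ 1F +ᶜ offsetᶜ (varᶜ 0F))

  -- Stages never exceed the count and some stage attains it, so the inequality for the true ratio
  -- is equivalent to an existential one over s.
  frequently-Π₂ : IsΠ⁰₂ℚ (Frequently C?)
  frequently-Π₂ = ∀Σ₁⇒Π₂ {Q = λ w → ∃[ y ] F (y ∷ w) ≡ 0} (F , cF , λ w → mk⇔ id id) λ
    { (a ∷ b ∷ c ∷ []) → mk⇔ (forth a b c) (back a b c) }
    where
    forth : ∀ a b c → Frequently C? (decodeℚ (a ∷ b ∷ c ∷ [])) → ∀ N →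
        ∃[ y ] F (y ∷ N ∷ a ∷ b ∷ c ∷ []) ≡ 0
    forth a b c freq N =
      let m , N≤m , le = freq N
          s , reach    = count≤stage (suc m)
          y , y₁ , y₂  = unpair-surjective (m ℕ.∸ N) s
      in y , trans (cong₂ (λ s k → excess s k a b c N) y₂ y₁)
               (subst (λ k → a ℕ.* suc k ℕ.∸ (stage s (suc k) ℕ.* suc c ℕ.+ b ℕ.* suc k) ≡ 0)
                   (sym (ℕ.m+[n∸m]≡n N≤m))
                 (ℕ.m≤n⇒m∸n≡0 (ℕ.≤-trans (to (decodeℚ-≤-⁄ a b c) le)
                   (ℕ.+-monoˡ-≤ (b ℕ.* suc m) (ℕ.*-monoˡ-≤ (suc c) reach)))))
    back : ∀ a b c → (∀ N → ∃[ y ] F (y ∷ N ∷ a ∷ b ∷ c ∷ []) ≡ 0) →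
        Frequently C? (decodeℚ (a ∷ b ∷ c ∷ []))
    back a b c all N =
      let y , eq = all N
          m = N ℕ.+ π₁ y
      in m , ℕ.m≤m+n N (π₁ y) , from (decodeℚ-≤-⁄ a b c) (ℕ.≤-trans (ℕ.m∸n≡0⇒m≤n eq)
           (ℕ.+-monoˡ-≤ (b ℕ.* suc m) (ℕ.*-monoˡ-≤ (suc c) (stage≤count (π₂ y) (suc m)))))

module LimSup (em : ExcludedMiddle 0ℓ) where
  open Classical em

  -- If S has a largest element then its Π⁰₂ description includes the endpoint, which
  -- the strict cut must not; but that cut is then rational.
  real-from-Π₂ : ∀ {S : Pred ℚ 0ℓ} → IsΠ⁰₂ℚ S → (∀ {p q} → p < q → q ∈ S → p ∈ S) →
    ∃[ q ] q ∈ S → ∃[ q ] q ∉ S →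
    Σ[ α ∈ ℝ ] (LeftΠ⁰₂ α × cut α ⊆ S × (∀ {p q} → p < q → q ∈ S → p ∈ cut α))
  real-from-Π₂ {S} S-Π₂ down inh prop with em {∃[ w ] (w ∈ S × (∀ q → q ∈ S → q ≤ w))}
  ... | yes (w , w∈S , max) = fromℚ w , fromℚ-leftΠ₂ w , (λ p<w → down p<w w∈S) , λ p<q q∈S →
      <-≤-trans p<q (max _ q∈S)
  ... | no  ¬max = record
    { cut = S ; inhabited = inh ; proper = prop ; downward = down
    ; open′ = λ {p} p∈S → by-contradiction λ none →
        ¬max (p , p∈S , λ q q∈S → ≮⇒≥ λ p<q → none (q , p<q , q∈S)) } , S-Π₂ , id , down

  limsup : ∀ {C : Pred ℕ 0ℓ} (C? : Decidable C) → ComputablyEnumerable C →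
    Σ[ α ∈ ℝ ] (LeftΠ⁰₂ α × cut α ⊆ Frequently C? ×
        (∀ {p q} → p < q → q ∈ Frequently C? → p ∈ cut α))
  limsup C? ce = real-from-Π₂ (frequently-Π₂ C? (ce⇒Σ₁ ce)) (frequently-downward C?)
    (0ℚ , λ N → N , ℕ.≤-refl , 0≤⁄ _ N)
    (1ℚ + 1ℚ , λ freq → let m , _ , le = freq 0 in
      <-irrefl refl (<-≤-trans (p<p+ε 1ℚ {1ℚ} (positive⁻¹ 1ℚ)) (≤-trans le (ratio≤1 C? m))))

  -- From d.c.e. sets to differences of left-Π⁰₂ reals.

  module Density {X : Pred ℕ 0ℓ} {X? : Decidable X} {r : ℝ} (density : IsDensity X? r) where

    eventually-above : ∀ {p q} → p < q → q ∈ cut r → ∃[ N ] (∀ m → N ℕ.≤ m → p < ratio X? m)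
    eventually-above {p} {q} p<q q∈r =
      let N , close = density (q - p) (0<q-p p<q) in
      N , λ m N≤m → cancel {ratio X? m}
          (∈-∉⇒< r q∈r (subst (λ x → x + (q - p) ∉ cut r) (ρ≡ratio X? m)
                              (<fromℚ⇒∉ r (proj₂ (close (suc m) (ℕ.m≤n⇒m≤1+n N≤m))))))
      where
      open +-*-Solver
      regroup : ∀ p q x → x + (q - p) + (p - q) ≡ x
      regroup = solve 3 (λ p q x → x :+ (q :- p) :+ (p :- q) := x) refl
      regroup′ : ∀ p q → q + (p - q) ≡ p
      regroup′ = solve 2 (λ p q → q :+ (p :- q) := p) refl
      cancel : ∀ {x} → q < x + (q - p) → p < x
      cancel {x} lt = subst₂ _<_ (regroup′ p q) (regroup p q x) (+-monoˡ-< (p - q) lt)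

    frequently-below : ∀ {p q} → p < q → q ∈ Frequently X? → p ∈ cut r
    frequently-below {p} {q} p<q freq =
      let N , close = density (q - p) (0<q-p p<q)
          m , N≤m , q≤ratio = freq N
      in downward-≤ r (subst (_≤ ratio X? m - (q - p)) (regroup p q)
          (+-monoˡ-≤ (- (q - p)) q≤ratio))
           (subst (λ x → x - (q - p) ∈ cut r) (ρ≡ratio X? m)
               (fromℚ<⇒∈ r (proj₁ (close (suc m) (ℕ.m≤n⇒m≤1+n N≤m)))))
      where
      open +-*-Solver
      regroup : ∀ p q → q - (q - p) ≡ p
      regroup = solve 2 (λ p q → q :- (q :- p) := p) refl

    0≤density : fromℚ 0ℚ ≤ᵣ r
    0≤density q<0 = frequently-below q<0 λ N → N , ℕ.≤-refl , 0≤⁄ _ N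

    density≤1 : r ≤ᵣ fromℚ 1ℚ
    density≤1 q∈r =
      let q′ , q<q′ , q′∈r = open′ r q∈r
          N , above = eventually-above q<q′ q′∈r
      in <-≤-trans (above N ℕ.≤-refl) (ratio≤1 X? N)

  ce-∪ : ∀ {A B : Pred ℕ 0ℓ} → ComputablyEnumerable A → ComputablyEnumerable B →
      ComputablyEnumerable (A ∪ B)
  ce-∪ ceA ceB = Σ₁⇒ce em (Σ₁-∪ (ce⇒Σ₁ ceA) (ce⇒Σ₁ ceB))

  module _ {A B X : Pred ℕ 0ℓ} (ceA : ComputablyEnumerable A) (ceB : ComputablyEnumerable B)
      (X≐ : X ≐ A ∖ B)
           {r : ℝ} (density : IsDensity {X} (λ _ → em) r) where
    private
      open Density {X = X} {X? = λ _ → em} {r = r} density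
      D = A ∪ B
      D? : Decidable D
      D? _ = em
      B? : Decidable B
      B? _ = em
      X? : Decidable X
      X? _ = em

      -- A need not contain B, so the counts of A and B do not subtract; A ∪ B is the disjoint union
      -- of X and B, so these do.
      indicator-split : ∀ n → indicator (D? n) ≡ indicator (X? n) ℕ.+ indicator (B? n)
      indicator-split n with D? n | X? n | B? n
      ... | yes _         | yes x  | yes b = contradiction b (proj₂ (proj₁ X≐ x))
      ... | yes _         | yes _  | no _  = refl
      ... | yes _         | no _   | yes _ = refl
      ... | yes (inj₁ a)  | no ¬x  | no ¬b = contradiction (proj₂ X≐ (a , ¬b)) ¬x
      ... | yes (inj₂ b)  | no _   | no ¬b = contradiction b ¬b
      ... | no ¬d         | yes x  | _     = contradiction (inj₁ (proj₁ (proj₁ X≐ x))) ¬d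
      ... | no ¬d         | _      | yes b = contradiction (inj₂ b) ¬d
      ... | no _          | no _   | no _  = refl

      count-split : ∀ m → count D? m ≡ count X? m ℕ.+ count B? m
      count-split m = trans
        (ℕ.≤-antisym (∑<-mono m λ i _ → ℕ.≤-reflexive (indicator-split i))
            (∑<-mono m λ i _ → ℕ.≤-reflexive (sym (indicator-split i))))
        (∑<-+ m (indicator ∘ X?) (indicator ∘ B?))

      ratio-split : ∀ m → ratio D? m ≡ ratio X? m + ratio B? m
      ratio-split m = trans (cong (_⁄ m) (count-split (suc m)))
          (⁄-+-same (count X? (suc m)) (count B? (suc m)) m)

    dce-density : (fromℚ 0ℚ ≤ᵣ r × r ≤ᵣ fromℚ 1ℚ) × r ∈ 𝓓₂
    dce-density =
      let α , α-Π₂ , α⊆ , ⊆α = limsup D? (ce-∪ ceA ceB)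
          β , β-Π₂ , β⊆ , ⊆β = limsup B? ceB
      in (0≤density , density≤1) , α , β , α-Π₂ , β-Π₂ , (λ {q} → below α β ⊆α β⊆ {q}) , λ {q} →
          above α β α⊆ ⊆β {q}
      where
      open +-*-Solver
      cancel₁ : ∀ q p l → q + (l + (p - q)) ≡ p + l
      cancel₁ = solve 3 (λ q p l → q :+ (l :+ (p :- q)) := p :+ l) refl
      cancel₂ : ∀ q z → q + (z - q) ≡ z
      cancel₂ = solve 2 (λ q z → q :+ (z :- q) := z) refl
      cancel₃ : ∀ q t → t + q - q ≡ t
      cancel₃ = solve 2 (λ q t → t :+ q :- q := t) refl

      module _ (α β : ℝ) where
        below : (∀ {p q} → p < q → q ∈ Frequently D? → p ∈ cut α) → cut β ⊆ Frequently B? →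
                cut r ⊆ cut (α -ᵣ β)
        below ⊆α β⊆ {q} q∈r =
          -- Each gap has a use: q₃ < q₄ makes the ratios of X eventually exceed q₃, q₂ < q₃ enters
          -- the cut of α strictly, q₁ < q₂ gives the final strict inequality, and q₁ - q is the
          -- precision to which β is enclosed.
          let q₄ , q<q₄ , q₄∈r  = open′ r q∈r
              q₃ , q<q₃ , q₃<q₄ = <-dense q<q₄
              q₂ , q<q₂ , q₂<q₃ = <-dense q<q₃
              q₁ , q<q₁ , q₁<q₂ = <-dense q<q₂
              N , eventually    = eventually-above q₃<q₄ q₄∈r
              l , l∈β , t∉β     = approximate β (0<q-p q<q₁)
              frequently : q₃ + l ∈ Frequently D?
              frequently = λ N′ →
                let m , N+N′≤m , l≤ = β⊆ l∈β (N ℕ.+ N′) in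
                m , ℕ.≤-trans (ℕ.m≤n+m N′ N) N+N′≤m ,
                subst (q₃ + l ≤_) (sym (ratio-split m))
                  (+-mono-≤ (<⇒≤ (eventually m (ℕ.≤-trans (ℕ.m≤m+n N N′) N+N′≤m))) l≤)
          in q₂ + l , l + (q₁ - q) , ⊆α (+-monoˡ-< l q₂<q₃) frequently , t∉β ,
             p<q-r (subst (_< q₂ + l) (sym (cancel₁ q q₁ l)) (+-monoˡ-< l q₁<q₂))

        above : cut α ⊆ Frequently D? → (∀ {p q} → p < q → q ∈ Frequently B? → p ∈ cut β) →
                cut (α -ᵣ β) ⊆ cut r
        above α⊆ ⊆β {q} (s , t , s∈α , t∉β , q<s-t) =
          -- The point z - q lies strictly beyond t, so the ratios of B are eventually below it; z <
          -- s leaves room for q below s - (z - q).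
          let z , q+t<z , z<s = <-dense (p+r<q {q} {s} {t} q<s-t)
              t<t′ : t < z - q
              t<t′ = p<q-r (subst (_< z) (+-comm q t) q+t<z)
              N , small = by-contradiction
                  λ (none : ¬ (∃[ N ] (∀ m → N ℕ.≤ m → ratio B? m < z - q))) →
                t∉β (⊆β t<t′ λ N → by-contradiction λ never →
                  none (N , λ m N≤m → ≰⇒> λ le → never (m , N≤m , le)))
              frequently : s - (z - q) ∈ Frequently X?
              frequently = λ N′ →
                let m , N+N′≤m , s≤ = α⊆ s∈α (N ℕ.+ N′) in
                m , ℕ.≤-trans (ℕ.m≤n+m N′ N) N+N′≤m ,
                subst (s - (z - q) ≤_) (cancel₃ (z - q) (ratio X? m)) (+-monoˡ-≤ (- (z - q))
                  (≤-trans s≤ (≤-trans (≤-reflexive (ratio-split m))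
                    (+-monoʳ-≤ (ratio X? m) (<⇒≤ (small m (ℕ.≤-trans (ℕ.m≤m+n N N′) N+N′≤m)))))))
          in frequently-below (p<q-r (subst (_< s) (sym (cancel₂ q z)) z<s)) frequently

-- From differences of left-Π⁰₂ reals to d.c.e. sets.

position : ℕ → ℚ
position n = offset n ⁄ block n

below⇒< : ∀ {u v} n → position-below u (suc v) n → position n < u ⁄ v
below⇒< _ = from ⁄-<

<⇒below : ∀ {u v} n → position n < u ⁄ v → position-below u (suc v) n
<⇒below _ = to ⁄-<

-- Given P u v ⇔ ∀ x → Q x u v with Q Σ₁, the c.e. set Approx consists of the n such that
-- no u/(1+v) ≤ position n with u, v ≤ n has been seen to fail P by the instances x ≤ n of
-- its Π₂ description. For downward closed P it contains all n whose position satisfies P,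
-- and only finitely many n whose position is at least a given rational failing P.
module Approximation (em : ExcludedMiddle 0ℓ) {Q : Pred (Vec ℕ 3) 0ℓ} (Q-Σ₁ : Σ₁ Q)
  {P : ℕ → ℕ → Set} (P⇔ : ∀ u v → P u v ⇔ (∀ x → Q (x ∷ u ∷ v ∷ []))) where
  open Classical em

  private
    Approx′ : Pred (Vec ℕ 1) 0ℓ
    Approx′ w = ∀ u → u ℕ.< suc (lookup w 0F) → ∀ v → v ℕ.< suc (lookup w 0F) →
      -- This equation is the decidable form of u/(1 + v) ≤ position n.
      u ℕ.* suc (block (lookup w 0F)) ℕ.∸ offset (lookup w 0F) ℕ.* suc v ≡ 0 →
      ∀ x → x ℕ.< suc (lookup w 0F) → Q (x ∷ u ∷ v ∷ [])

    Approx′-Σ₁ : Σ₁ Approx′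
    Approx′-Σ₁ =
      Σ₁-∀< {P = λ w → ∀ v → v ℕ.< suc (lookup w 1F) →
               lookup w 0F ℕ.* suc (block (lookup w 1F)) ℕ.∸ offset (lookup w 1F) ℕ.* suc v ≡ 0 →
               ∀ x → x ℕ.< suc (lookup w 1F) → Q (x ∷ lookup w 0F ∷ v ∷ [])}
        (Σ₁-∀< {P = λ w →
               lookup w 1F ℕ.* suc (block (lookup w 2F)) ℕ.∸ offset (lookup w 2F) ℕ.* suc
                   (lookup w 0F) ≡ 0 →
               ∀ x → x ℕ.< suc (lookup w 2F) → Q (x ∷ lookup w 1F ∷ lookup w 0F ∷ [])}
          (Σ₁-→ (varᶜ 1F *ᶜ sucᶜ (blockᶜ (varᶜ 2F)) ∸ᶜ offsetᶜ (varᶜ 2F) *ᶜ sucᶜ (varᶜ 0F))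
            (Σ₁-∀< {P = λ w → Q (lookup w 0F ∷ lookup w 2F ∷ lookup w 1F ∷ [])}
              (Σ₁-∘ Q-Σ₁ (varᶜ 0F ∷ᶜ varᶜ 2F ∷ᶜ varᶜ 1F ∷ᶜ []ᶜ)) (sucᶜ (varᶜ 2F))))
          (sucᶜ (varᶜ 1F)))
        (sucᶜ (varᶜ 0F))

  Approx : Pred ℕ 0ℓ
  Approx n = Approx′ (n ∷ [])

  Approx-ce : ComputablyEnumerable Approx
  Approx-ce = Σ₁⇒ce em Approx′-Σ₁

  Approx-complete : ∀ n → (∀ u v → u ⁄ v ≤ position n → P u v) → Approx n
  Approx-complete n all u _ v _ eq x _ = to (P⇔ u v) (all u v (from ⁄-≤ (ℕ.m∸n≡0⇒m≤n eq))) x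

  Approx-sound : ∀ u v → ¬ P u v → ∃[ K ] (∀ n → K ℕ.≤ n → Approx n → position-below u (suc v) n)
  Approx-sound u v ¬p =
    let x , ¬q = by-contradiction λ none →
            ¬p (from (P⇔ u v) λ x → by-contradiction λ ¬q → none (x , ¬q))
    -- From here on n bounds u, v and the failing instance x, so the failure is within the range
    -- that `Approx` inspects.
    in u ℕ.+ v ℕ.+ x , λ n K≤n n∈ → ℕ.≰⇒> λ le → ¬q
      (n∈ u (ℕ.s≤s (ℕ.≤-trans (ℕ.≤-trans (ℕ.m≤m+n u v) (ℕ.m≤m+n _ x)) K≤n))
          v (ℕ.s≤s (ℕ.≤-trans (ℕ.≤-trans (ℕ.m≤n+m v u) (ℕ.m≤m+n _ x)) K≤n))
          (ℕ.m≤n⇒m∸n≡0 le)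
          x (ℕ.s≤s (ℕ.≤-trans (ℕ.m≤n+m x _) K≤n)))

-- The two cuts are moved into [0,1) by the rational c₀.
shifted-Π₂ : ∀ (a : ℝ) c₀ → LeftΠ⁰₂ a →
  ∃[ Q ] (Σ₁ {3} Q × (∀ u v → c₀ + u ⁄ v ∈ cut a ⇔ (∀ x → Q (x ∷ u ∷ v ∷ []))))
shifted-Π₂ a c₀ a-Π₂ =
  let e , f , g , eq  = decodeℚ-surjective c₀
      Q , Q-Σ₁ , Q⇔ = Π₂⇒∀Σ₁ a-Π₂
  in (λ w → Q (lookup w 0F ∷ code e f g (tail w))) , Σ₁-∘ Q-Σ₁ (varᶜ 0F ∷ᶜ weakenᶜ (codeᶜ e f g)) ,
     λ u v → subst (λ q → q ∈ cut a ⇔ (∀ x → Q (x ∷ code e f g (u ∷ v ∷ []))))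
               (trans (sym (decodeℚ-+-⁄ e f g u v)) (cong (_+ u ⁄ v) eq))
                   (Q⇔ (code e f g (u ∷ v ∷ [])))
  where
  code : ℕ → ℕ → ℕ → Vec ℕ 2 → Vec ℕ 3
  code e f g w = e ℕ.* suc (lookup w 1F) ℕ.+ lookup w 0F ℕ.* suc g ∷ f ℕ.* suc (lookup w 1F) ∷
                 lookup w 1F ℕ.+ g ℕ.* suc (lookup w 1F) ∷ []
  codeᶜ : ∀ e f g → Computables (code e f g)
  codeᶜ e f g = litᶜ e *ᶜ sucᶜ (varᶜ 1F) +ᶜ varᶜ 0F *ᶜ sucᶜ (litᶜ g) ∷ᶜ litᶜ f *ᶜ sucᶜ (varᶜ 1F) ∷ᶜ
                varᶜ 1F +ᶜ litᶜ g *ᶜ sucᶜ (varᶜ 1F) ∷ᶜ []ᶜ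

module Realize (em : ExcludedMiddle 0ℓ) (a b : ℝ) (a-Π₂ : LeftΠ⁰₂ a) (b-Π₂ : LeftΠ⁰₂ b)
  {r : ℝ} (r≃ : r ≃ᵣ a -ᵣ b) (b⊆a : cut b ⊆ cut a) {c₀ : ℚ} (c₀∈b : c₀ ∈ cut b)
      (c₀+1∉a : c₀ + 1ℚ ∉ cut a) where
  open Classical em

  private
    Qa = shifted-Π₂ a c₀ a-Π₂
    Qb = shifted-Π₂ b c₀ b-Π₂

    module A = Approximation em (proj₁ (proj₂ Qa)) (proj₂ (proj₂ Qa))
    module B = Approximation em (proj₁ (proj₂ Qb)) (proj₂ (proj₂ Qb))

  X : Pred ℕ 0ℓ
  X = A.Approx ∖ B.Approx

  X-dce : IsDCE X
  X-dce = A.Approx , B.Approx , A.Approx-ce , B.Approx-ce , id , id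

  private
    X? : Decidable X
    X? _ = em

    module Grid (M : ℕ) where

      cell : (d : ℝ) → c₀ ∈ cut d → c₀ + 1ℚ ∉ cut d →
          ∃[ i ] (i ℕ.< suc M × c₀ + i ⁄ M ∈ cut d × c₀ + suc i ⁄ M ∉ cut d)
      cell d c₀∈d c₀+1∉d = last-before (λ i → c₀ + i ⁄ M ∈ cut d) (suc M)
        (subst (_∈ cut d) (sym (trans (cong (_+_ c₀) (0⁄ M)) (+-identityʳ c₀))) c₀∈d)
        (subst (λ x → c₀ + x ∉ cut d) (sym (n⁄n M)) c₀+1∉d)

      module _ {i j : ℕ} (i<M : i ℕ.< suc M) (j<M : j ℕ.< suc M)
        (i∈a : c₀ + i ⁄ M ∈ cut a) (1+i∉a : c₀ + suc i ⁄ M ∉ cut a)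
        (j∈b : c₀ + j ⁄ M ∈ cut b) (1+j∉b : c₀ + suc j ⁄ M ∉ cut b) where

        covers : ∀ (d : ℝ) {k} n → c₀ + k ⁄ M ∈ cut d → position-below k (suc M) n → ∀ u v →
            u ⁄ v ≤ position n → c₀ + u ⁄ v ∈ cut d
        covers d n k∈d below u v le = downward d (+-monoʳ-< c₀ (≤-<-trans le (below⇒< n below))) k∈d

        Ka = proj₁ (A.Approx-sound (suc i) M 1+i∉a)
        Kb = proj₁ (B.Approx-sound (suc j) M 1+j∉b)

        below-j⇒below-i : ∀ n → position-below j (suc M) n → position-below (suc i) (suc M) n
        below-j⇒below-i n below = <⇒below n (≰⇒> λ le →
          1+i∉a (downward a (+-monoʳ-< c₀ (≤-<-trans le (below⇒< n below))) (b⊆a j∈b)))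

        -- Points below cell j lie in B and hence outside X, so the two indicators on the left are
        -- never both 1. Far out, A lies below the end of cell i, and so do the points below cell j
        -- since `b⊆a`.
        upper : ∀ n → Ka ℕ.+ Kb ℕ.≤ n →
            indicator (X? n) ℕ.+ indicator (position-below? j (suc M) n) ℕ.≤
            indicator (position-below? (suc i) (suc M) n)
        upper n K≤n = cases (X? n) (position-below? j (suc M) n) (position-below? (suc i) (suc M) n)
          where
          cases : (x : Dec (X n)) (y : Dec (position-below j (suc M) n))
              (z : Dec (position-below (suc i) (suc M) n)) →
              indicator x ℕ.+ indicator y ℕ.≤ indicator z
          cases (yes (_ , n∉B)) (yes y) _  = contradiction
              (B.Approx-complete n (covers b n j∈b y)) n∉B
          cases (yes (n∈A , _)) _ (no ¬z)  = contradiction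
              (proj₂ (A.Approx-sound (suc i) M 1+i∉a) n (ℕ.≤-trans (ℕ.m≤m+n Ka Kb) K≤n) n∈A) ¬z
          cases (yes _) (no _)  (yes _)    = ℕ.≤-refl
          cases (no _)  (yes y) (no ¬z)    = contradiction (below-j⇒below-i n y) ¬z
          cases (no _)  (yes _) (yes _)    = ℕ.≤-refl
          cases (no _)  (no _)  z          = ℕ.z≤n

        -- A point below cell i lies in A; it can miss X only by lying in B, which far out forces it
        -- below the end of cell j.
        lower : ∀ n → Ka ℕ.+ Kb ℕ.≤ n →
            indicator (position-below? i (suc M) n) ℕ.≤ indicator (X? n) ℕ.+
            indicator (position-below? (suc j) (suc M) n)
        lower n K≤n = cases (X? n) (position-below? i (suc M) n) (position-below? (suc j) (suc M) n)
          where
          cases : (x : Dec (X n)) (y : Dec (position-below i (suc M) n))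
              (z : Dec (position-below (suc j) (suc M) n)) →
              indicator y ℕ.≤ indicator x ℕ.+ indicator z
          cases _        (no _)  _       = ℕ.z≤n
          cases (yes _)  (yes _) _       = ℕ.s≤s ℕ.z≤n
          cases (no _)   (yes _) (yes _) = ℕ.≤-refl
          cases (no n∉X) (yes y) (no ¬z) = contradiction
            (A.Approx-complete n (covers a n i∈a y) ,
             λ n∈B → ¬z (proj₂ (B.Approx-sound (suc j) M 1+j∉b) n (ℕ.≤-trans (ℕ.m≤n+m Kb Ka) K≤n)
                 n∈B)) n∉X

        close : ∃[ m₀ ] (∀ m → m₀ ℕ.≤ suc m → ratio X? m + j ⁄ M ≤ (2 ℕ.+ i) ⁄ M ×
            i ⁄ M ≤ ratio X? m + (2 ℕ.+ j) ⁄ M)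
        close = let m₀ , bounds = grid-density X? i<M j<M (Ka ℕ.+ Kb) upper lower in
          m₀ , λ m m₀≤m → let up , down = bounds (suc m) m₀≤m in from-up m up , from-down m down
          where
          from-up : ∀ m → suc M ℕ.* count X? (suc m) ℕ.+ j ℕ.* suc m ℕ.≤ (2 ℕ.+ i) ℕ.* suc m →
              ratio X? m + j ⁄ M ≤ (2 ℕ.+ i) ⁄ M
          from-up m le = subst (_≤ (2 ℕ.+ i) ⁄ M) (sym (⁄-+ (count X? (suc m)) m j M))
            (from ⁄-≤ (ℕ.≤-trans (ℕ.*-monoˡ-≤ (suc M)
                (subst (λ z → z ℕ.+ j ℕ.* suc m ℕ.≤ (2 ℕ.+ i) ℕ.* suc m)
                (ℕ.*-comm (suc M) (count X? (suc m))) le))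
              (ℕ.≤-reflexive (ℕ.*-assoc (2 ℕ.+ i) (suc m) (suc M)))))
          from-down : ∀ m → i ℕ.* suc m ℕ.≤ suc M ℕ.* count X? (suc m) ℕ.+ (2 ℕ.+ j) ℕ.* suc m →
              i ⁄ M ≤ ratio X? m + (2 ℕ.+ j) ⁄ M
          from-down m le = subst (i ⁄ M ≤_) (sym (⁄-+ (count X? (suc m)) m (2 ℕ.+ j) M))
            (from ⁄-≤ (ℕ.≤-trans (ℕ.≤-reflexive (sym (ℕ.*-assoc i (suc m) (suc M))))
                (ℕ.*-monoˡ-≤ (suc M)
              (subst (λ z → i ℕ.* suc m ℕ.≤ z ℕ.+ (2 ℕ.+ j) ℕ.* suc m)
                  (ℕ.*-comm (suc M) (count X? (suc m))) le))))

        below-difference : ∀ {q} → q + suc j ⁄ M < i ⁄ M → q ∈ cut r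
        below-difference {q} lt = proj₂ r≃ (c₀ + i ⁄ M , c₀ + suc j ⁄ M , i∈a , 1+j∉b ,
          p<q-r (subst (_< c₀ + i ⁄ M) (regroup q c₀ (suc j ⁄ M)) (+-monoʳ-< c₀ lt)))
          where
          open +-*-Solver
          regroup : ∀ q c j → c + (q + j) ≡ q + (c + j)
          regroup = solve 3 (λ q c j → c :+ (q :+ j) := q :+ (c :+ j)) refl

        above-difference : suc i ⁄ M - j ⁄ M ∉ cut r
        above-difference ∈r with proj₁ r≃ ∈r
        ... | s , t , s∈a , t∉b , lt = <-asym lt
          (subst (s - t <_) (regroup c₀ (suc i ⁄ M) (j ⁄ M))
              (+-mono-< (∈-∉⇒< a s∈a 1+i∉a) (neg-antimono-< (∈-∉⇒< b j∈b t∉b))))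
          where
          open +-*-Solver
          regroup : ∀ c i j → c + i - (c + j) ≡ i - j
          regroup = solve 3 (λ c i j → c :+ i :- (c :+ j) := i :- j) refl

        -- The ratios, the grid cells and the cut r disagree by less than 4/M in all.
        squeeze : ∀ {ε} → 4 ⁄ M ≤ ε → ∃[ N ] (∀ m → N ℕ.≤ suc m →
          fromℚ (ratio X? m - ε) <ᵣ r × r <ᵣ fromℚ (ratio X? m + ε))
        squeeze {ε} 4/M≤ε = proj₁ close , λ m m₀≤m →
          let up , down = proj₂ close m m₀≤m in
          ∈⇒fromℚ< r (below-difference (under m up)) ,
              (suc i ⁄ M - j ⁄ M , above-difference , over m down)
          where
          open +-*-Solver
          shift : ∀ k l → (k ℕ.+ l) ⁄ M ≡ l ⁄ M + k ⁄ M
          shift k l = trans (⁄-+-same k l M) (+-comm (k ⁄ M) (l ⁄ M))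
          -- Two cells are lost in `close` and one to the cell widths in the difference cut; the
          -- fourth makes the inequality strict.
          3<4 : 3 ⁄ M < 4 ⁄ M
          3<4 = from ⁄-< (ℕ.*-monoˡ-< (suc M) (ℕ.n<1+n 3))
          3≡ : 2 ⁄ M + 1 ⁄ M ≡ 3 ⁄ M
          3≡ = sym (⁄-+-same 2 1 M)
          under : ∀ m → ratio X? m + j ⁄ M ≤ (2 ℕ.+ i) ⁄ M → ratio X? m - ε + suc j ⁄ M < i ⁄ M
          under m up = subst₂ _<_ (eq₁ (ratio X? m) (j ⁄ M) (1 ⁄ M) ε (shift 1 j)) (eq₂ (i ⁄ M) ε)
            (+-monoˡ-< (- ε) (≤-<-trans (≤-trans (+-monoˡ-≤ (1 ⁄ M) up) (≤-reflexive eq₃))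
                (<-≤-trans (+-monoʳ-< (i ⁄ M) 3<4) (+-monoʳ-≤ (i ⁄ M) 4/M≤ε))))
            where
            eq₁ : ∀ x j k e {l} → l ≡ j + k → x + j + k - e ≡ x - e + l
            eq₁ x j k e refl = solve 4 (λ x j k e → x :+ j :+ k :- e := x :- e :+ (j :+ k)) refl x
                j k e
            eq₂ : ∀ i e → i + e - e ≡ i
            eq₂ = solve 2 (λ i e → i :+ e :- e := i) refl
            eq₃ : (2 ℕ.+ i) ⁄ M + 1 ⁄ M ≡ i ⁄ M + 3 ⁄ M
            eq₃ = trans (cong (_+ 1 ⁄ M) (shift 2 i))
                (trans (+-assoc (i ⁄ M) _ _) (cong (_+_ (i ⁄ M)) 3≡))
          over : ∀ m → i ⁄ M ≤ ratio X? m + (2 ℕ.+ j) ⁄ M → suc i ⁄ M - j ⁄ M < ratio X? m + ε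
          over m down = subst₂ _<_ (cong (_- j ⁄ M) (sym (shift 1 i))) (eq₂ (ratio X? m) (j ⁄ M) ε)
            (+-monoˡ-< (- (j ⁄ M)) (≤-<-trans (≤-trans (+-monoˡ-≤ (1 ⁄ M) down) (≤-reflexive eq₃))
                (<-≤-trans (+-monoʳ-< (ratio X? m + j ⁄ M) 3<4)
                (+-monoʳ-≤ (ratio X? m + j ⁄ M) 4/M≤ε))))
            where
            eq₂ : ∀ x j e → x + j + e - j ≡ x + e
            eq₂ = solve 3 (λ x j e → x :+ j :+ e :- j := x :+ e) refl
            eq₄ : ∀ x j k l → x + (j + k) + l ≡ x + j + (k + l)
            eq₄ = solve 4 (λ x j k l → x :+ (j :+ k) :+ l := x :+ j :+ (k :+ l)) refl
            eq₃ : ratio X? m + (2 ℕ.+ j) ⁄ M + 1 ⁄ M ≡ ratio X? m + j ⁄ M + 3 ⁄ M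
            eq₃ = trans (cong (λ z → ratio X? m + z + 1 ⁄ M) (shift 2 j))
                (trans (eq₄ (ratio X? m) (j ⁄ M) (2 ⁄ M) (1 ⁄ M))
                (cong (_+_ (ratio X? m + j ⁄ M)) 3≡))

  X-density : IsDensity X? r
  X-density ε 0<ε =
    let c , 1/c≤ε = ε-unit 0<ε
        -- Then M + 1 = 4(c + 1), so four grid cells have total width exactly 1/(c + 1).
        M = 3 ℕ.+ 4 ℕ.* c
        open Grid M
        i , i<M , i∈a , 1+i∉a = cell a (b⊆a c₀∈b) c₀+1∉a
        j , j<M , j∈b , 1+j∉b = cell b c₀∈b (c₀+1∉a ∘ b⊆a)
        N , good = squeeze i<M j<M i∈a 1+i∉a j∈b 1+j∉b
            (≤-trans (from ⁄-≤ (ℕ.≤-reflexive (four c))) 1/c≤ε)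
    in N , λ { (suc m) N≤m → subst (λ x → fromℚ (x - ε) <ᵣ r × r <ᵣ fromℚ (x + ε))
        (sym (ρ≡ratio X? m)) (good m N≤m) }
    where
    four : ∀ c → 4 ℕ.* suc c ≡ 1 ℕ.* suc (3 ℕ.+ 4 ℕ.* c)
    four = ℕ.solve-∀

-- The case r = 1 and the choice of c₀.

module Backward (em : ExcludedMiddle 0ℓ) where
  open Classical em

  full-density : ∀ (r : ℝ) → r ≤ᵣ fromℚ 1ℚ → (∀ {q} → q < 1ℚ → q ∈ cut r) →
      IsDensity {λ _ → ⊤} (λ _ → em) r
  full-density r r≤1 1≤r ε 0<ε = 0 , λ { (suc m) _ →
    subst (λ x → fromℚ (x - ε) <ᵣ r × r <ᵣ fromℚ (x + ε)) (sym (trans (ρ≡ratio (λ _ → em) m)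
      (trans (cong (_⁄ m) (count-all (λ _ → em) (λ _ → tt) (suc m))) (n⁄n m))))
      (∈⇒fromℚ< r (1≤r (p-ε<p 1ℚ 0<ε)) , (1ℚ , (λ 1∈r → <-irrefl refl (r≤1 1∈r)) , p<p+ε 1ℚ 0<ε)) }

  full-dce : IsDCE (λ _ → ⊤)
  full-dce = (λ _ → ⊤) , (λ _ → ⊥) ,
    inj₂ ((λ w → lookup w 0F) , varᶜ 0F , (λ {x} _ → x , refl) , λ _ → tt) ,
        inj₁ (λ _ ()) , (λ _ → tt , λ ()) , λ _ → tt

  𝓓₂⇒dce : ∀ (r : ℝ) → fromℚ 0ℚ ≤ᵣ r → r ≤ᵣ fromℚ 1ℚ → r ∈ 𝓓₂ →
      ∃[ X ] (IsDCE X × IsDensity {X} (λ _ → em) r)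
  𝓓₂⇒dce r 0≤r r≤1 (a , b , a-Π₂ , b-Π₂ , r≃) = cases (em {∃[ q ] (q < 1ℚ × q ∉ cut r)})
    where
    open +-*-Solver
    b⊆a : cut b ⊆ cut a
    b⊆a {x} x∈b =
      -- As 0 ≤ r, the negative number x - y is in the cut of r, hence below some s - t with s
      -- inside `a` and t outside `b`. Since y < t, this gives x < s.
      let y , x<y , y∈b = open′ b x∈b
          s , t , s∈a , t∉b , lt = proj₁ r≃
              (0≤r (subst (x - y <_) (+-inverseʳ y) (+-monoˡ-< (- y) x<y)))
      in downward a (subst (_< s) (regroup x y)
          (<-trans (+-monoʳ-< (x - y) (∈-∉⇒< b y∈b t∉b)) (p+r<q {x - y} {s} {t} lt))) s∈a
      where
      regroup : ∀ x y → x - y + y ≡ x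
      regroup = solve 2 (λ x y → x :- y :+ y := x) refl

    cases : Dec (∃[ q ] (q < 1ℚ × q ∉ cut r)) → ∃[ X ] (IsDCE X × IsDensity {X} (λ _ → em) r)
    cases (no none) = (λ _ → ⊤) , full-dce ,
      full-density r r≤1 λ q<1 → by-contradiction λ q∉r → none (_ , q<1 , q∉r)
    cases (yes (q , q<1 , q∉r)) =
      -- With r ≤ q < 1 one has a ≤ b + q. Approximating b from below within 1 - q therefore puts c₀
      -- + 1 at or above a.
      let c₀ , c₀∈b , c₀+δ∉b = approximate b (0<q-p q<1) in
      realize c₀∈b (outside {c₀} c₀+δ∉b)
      where
      realize : ∀ {c₀} → c₀ ∈ cut b → c₀ + 1ℚ ∉ cut a →
          ∃[ X ] (IsDCE X × IsDensity {X} (λ _ → em) r)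
      realize c₀∈b c₀+1∉a = let open Realize em a b a-Π₂ b-Π₂ {r} r≃ b⊆a c₀∈b c₀+1∉a in X , X-dce , X-density
      regroup : ∀ q c → c + 1ℚ ≡ q + (c + (1ℚ - q))
      regroup = solve 2 (λ q c → c :+ con 1ℚ := q :+ (c :+ (con 1ℚ :- q))) refl
      outside : ∀ {c₀} → c₀ + (1ℚ - q) ∉ cut b → c₀ + 1ℚ ∉ cut a
      outside {c₀} t∉b ∈a =
        let s , lt , s∈a = open′ a ∈a in
        q∉r (proj₂ r≃ (s , c₀ + (1ℚ - q) , s∈a , t∉b , p<q-r (subst (_< s) (regroup q c₀) lt)))

corollary3p6 : (em : ExcludedMiddle 0ℓ) (r : ℝ) →
    (∃[ X ] (IsDCE X × IsDensity {X} (λ _ → em) r))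
    ⇔ ((fromℚ 0ℚ ≤ᵣ r × r ≤ᵣ fromℚ 1ℚ) × r ∈ 𝓓₂)
corollary3p6 em r = mk⇔
  (λ { (X , (A , B , ceA , ceB , X≐) , density) → LimSup.dce-density em ceA ceB X≐ {r} density })
  (λ { ((0≤r , r≤1) , r∈𝓓₂) → Backward.𝓓₂⇒dce em r 0≤r r≤1 r∈𝓓₂ })
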